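{- Any $(\alpha,\beta)$-approximation algorithm for $(\mathbf A,\mathbf B,\mathbf S)$ can be transformed in polynomial time into a $(\beta,\alpha)$-approximation algorithm for $(\mathbf B,\mathbf A,\mathbf S)$.
   Context: Let $G$ be a graph with two integral (nonnegative) cost functions $c$ and $d$ (typically edge costs or node costs). $\mathbf A$ is a minimization objective computed using $c$, $\mathbf B$ is a minimization objective computed using $d$, and $\mathbf S$ is a class of subgraphs. The problem $(\mathbf A,\mathbf B,\mathbf S)$ is: given $G$ and a budget $\mathcal C$, find a subgraph in $\mathbf S$ whose $\mathbf A$-value (under $c$) is at most $\mathcal C$ and which has minimum $\mathbf B$-value (under $d$). The problem $(\mathbf B,\mathbf A,\mathbf S)$ is: given $G$ and a budget $\mathcal D$, find a subgraph in $\mathbf S$ whose $\mathbf B$-value (under $d$) is at most $\mathcal D$ and which has minimum $\mathbf A$-value (under $c$). An $(\alpha,\beta)$-approximation algorithm for an $(\mathbf A,\mathbf B,\mathbf S)$-bicriteria problem is a polynomial-time algorithm that produces a solution in $\mathbf S$ whose first objective ($\mathbf A$) value is at most $\alpha$ times the budget, and whose second objective ($\mathbf B$) value is at most $\beta$ times the minimum for any solution in $\mathbf S$ that is within the budget on $\mathbf A$. Standing assumptions: the two criteria are hostile, i.e. the minimum value of one objective is monotonically nondecreasing as the budget (bound) on the value of the other objective is decreased; and there is an upper bound $\mathcal C_{hi}$ on the $\mathbf A$-value of any subgraph in $\mathbf S$ within the budget $\mathcal D$ on $\mathbf B$ that is at most some polynomial in $n$ (the number of nodes) times the maximum $c$-cost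 of an edge or node, so that $\log\mathcal C_{hi}$ is polynomial in the input size.
   Formalization: The performance ratios α and β are taken to be nonnegative rational numbers (possibly depending on the instance, with β then computable in polynomial time) instead of real numbers. -}

module Defs where

open import Data.Bool using (Bool; true; false)
open import Data.Empty using (⊥)
open import Data.Fin using (Fin; toℕ)
open import Data.Fin.Subset using (Subset; _∈_)
import Data.Integer as ℤ
open import Data.List using (List; []; _∷_)
open import Data.Maybe using (Maybe; just; nothing)
open import Data.Nat using (ℕ; suc; _+_; _*_; _∸_; _≤_; _⊔_; _≤ᵇ_; ⌊_/2⌋)
open import Data.Nat.Logarithm using (⌊log₂_⌋)
open import Data.Nat.Properties using (≤-reflexive; *-comm; *-zeroʳ; +-identityʳ)
open import Data.Product using (∃-syntax; Σ-syntax; _×_; _,_; proj₁; proj₂)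
open import Data.Rational as ℚ using (ℚ)
open import Data.Sum using (_⊎_; inj₁; inj₂)
open import Data.Unit using (⊤; tt)
open import Data.Vec as Vec using (Vec; lookup)
open import Relation.Binary.PropositionalEquality using (_≡_; refl)
open import Relation.Nullary using (¬_)

-- Coefficients, constant term first.
Poly : Set
Poly = List ℕ

eval : Poly → ℕ → ℕ
eval []      x = 0
eval (a ∷ p) x = a + x * eval p x

-- A deep-embedded first-order language with unbounded iteration, over
-- natural numbers, booleans, pairs, sums and lists.  Running time is
-- logarithmic cost: a natural number occupies as many cells as it has binary
-- digits, and each primitive step costs the full size of the data it is
-- applied to.  Every primitive is computable by a Turing machine in time
-- polynomial in the size of its argument and enlarges its argument at most
-- by a constant factor plus a constant, and a Turing machine step can be
-- simulated on a pair of tape lists, so polynomial time here is the usual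
-- polynomial time.

infixr 6 _⊗_
infixr 5 _⊕_

data Ty : Set where
  unit bool nat : Ty
  _⊗_ _⊕_       : Ty → Ty → Ty
  list          : Ty → Ty

⟦_⟧ : Ty → Set
⟦ unit ⟧   = ⊤
⟦ bool ⟧   = Bool
⟦ nat ⟧    = ℕ
⟦ σ ⊗ τ ⟧  = ⟦ σ ⟧ × ⟦ τ ⟧
⟦ σ ⊕ τ ⟧  = ⟦ σ ⟧ ⊎ ⟦ τ ⟧
⟦ list σ ⟧ = List ⟦ σ ⟧

size : ∀ τ → ⟦ τ ⟧ → ℕ
size unit     _        = 1
size bool     _        = 1
size nat      n        = suc ⌊log₂ n ⌋
size (σ ⊗ τ)  (x , y)  = suc (size σ x + size τ y)
size (σ ⊕ τ)  (inj₁ x) = suc (size σ x)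
size (σ ⊕ τ)  (inj₂ y) = suc (size τ y)
size (list σ) []       = 1
size (list σ) (x ∷ xs) = suc (size σ x + size (list σ) xs)

data Prim : Ty → Ty → Set where
  id     : ∀ {σ} → Prim σ σ
  !      : ∀ {σ} → Prim σ unit
  fst    : ∀ {σ τ} → Prim (σ ⊗ τ) σ
  snd    : ∀ {σ τ} → Prim (σ ⊗ τ) τ
  inl    : ∀ {σ τ} → Prim σ (σ ⊕ τ)
  inr    : ∀ {σ τ} → Prim τ (σ ⊕ τ)
  bit    : ∀ {σ} → Bool → Prim σ bool
  lit    : ∀ {σ} → ℕ → Prim σ nat
  nil    : ∀ {σ τ} → Prim σ (list τ)
  cons   : ∀ {σ} → Prim (σ ⊗ list σ) (list σ)
  uncons : ∀ {σ} → Prim (list σ) (unit ⊕ σ ⊗ list σ)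
  add monus mul : Prim (nat ⊗ nat) nat
  half   : Prim nat nat
  leq    : Prim (nat ⊗ nat) bool

⟦_⟧ₚ : ∀ {σ τ} → Prim σ τ → ⟦ σ ⟧ → ⟦ τ ⟧
⟦ id ⟧ₚ     x        = x
⟦ ! ⟧ₚ      _        = tt
⟦ fst ⟧ₚ    (x , _)  = x
⟦ snd ⟧ₚ    (_ , y)  = y
⟦ inl ⟧ₚ    x        = inj₁ x
⟦ inr ⟧ₚ    y        = inj₂ y
⟦ bit b ⟧ₚ  _        = b
⟦ lit n ⟧ₚ  _        = n
⟦ nil ⟧ₚ    _        = []
⟦ cons ⟧ₚ   (x , xs) = x ∷ xs
⟦ uncons ⟧ₚ []       = inj₁ tt
⟦ uncons ⟧ₚ (x ∷ xs) = inj₂ (x , xs)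
⟦ add ⟧ₚ    (m , n)  = m + n
⟦ monus ⟧ₚ  (m , n)  = m ∸ n
⟦ mul ⟧ₚ    (m , n)  = m * n
⟦ half ⟧ₚ   n        = ⌊ n /2⌋
⟦ leq ⟧ₚ    (m , n)  = m ≤ᵇ n

infixr 9 _⨾_

-- C σ τ is the type of external subroutines from σ to τ that a program may call.
data Prog (C : Ty → Ty → Set) : Ty → Ty → Set where
  call : ∀ {σ τ} → C σ τ → Prog C σ τ
  prim : ∀ {σ τ} → Prim σ τ → Prog C σ τ
  _⨾_  : ∀ {ρ σ τ} → Prog C ρ σ → Prog C σ τ → Prog C ρ τ
  pair : ∀ {ρ σ τ} → Prog C ρ σ → Prog C ρ τ → Prog C ρ (σ ⊗ τ)
  case : ∀ {ρ σ σ′ τ} → Prog C (σ ⊗ ρ) τ → Prog C (σ′ ⊗ ρ) τ →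
         Prog C ((σ ⊕ σ′) ⊗ ρ) τ
  cond : ∀ {ρ τ} → Prog C ρ τ → Prog C ρ τ → Prog C (bool ⊗ ρ) τ
  -- The right summand is the exit.
  loop : ∀ {σ τ} → Prog C σ (σ ⊕ τ) → Prog C σ τ

-- A closed program calls nothing, so it has no rule for call below.
Closed : Ty → Ty → Set
Closed = Prog (λ _ _ → ⊥)

-- p ∙ x ⇓ y [ t ]: on input x, p halts with output y after time t.  Only
-- primitives are charged; as every program starts by applying primitives to
-- its whole input, the other constructs cost a constant factor at most.
infix 4 _∙_⇓_[_]

data _∙_⇓_[_] : ∀ {σ τ} → Closed σ τ → ⟦ σ ⟧ → ⟦ τ ⟧ → ℕ → Set where
  ⇓prim : ∀ {σ τ} {f : Prim σ τ} {x} → prim f ∙ x ⇓ ⟦ f ⟧ₚ x [ size σ x ]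
  ⇓⨾    : ∀ {ρ σ τ} {p : Closed ρ σ} {q : Closed σ τ} {x y z s t} →
          p ∙ x ⇓ y [ s ] → q ∙ y ⇓ z [ t ] → p ⨾ q ∙ x ⇓ z [ s + t ]
  ⇓pair : ∀ {ρ σ τ} {p : Closed ρ σ} {q : Closed ρ τ} {x y z s t} →
          p ∙ x ⇓ y [ s ] → q ∙ x ⇓ z [ t ] → pair p q ∙ x ⇓ (y , z) [ s + t ]
  ⇓inj₁ : ∀ {ρ σ σ′ τ} {p : Closed (σ ⊗ ρ) τ} {q : Closed (σ′ ⊗ ρ) τ} {x r y t} →
          p ∙ (x , r) ⇓ y [ t ] → case p q ∙ (inj₁ x , r) ⇓ y [ t ]
  ⇓inj₂ : ∀ {ρ σ σ′ τ} {p : Closed (σ ⊗ ρ) τ} {q : Closed (σ′ ⊗ ρ) τ} {x r y t} →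
          q ∙ (x , r) ⇓ y [ t ] → case p q ∙ (inj₂ x , r) ⇓ y [ t ]
  ⇓true : ∀ {ρ τ} {p q : Closed ρ τ} {r y t} →
          p ∙ r ⇓ y [ t ] → cond p q ∙ (true , r) ⇓ y [ t ]
  ⇓false : ∀ {ρ τ} {p q : Closed ρ τ} {r y t} →
          q ∙ r ⇓ y [ t ] → cond p q ∙ (false , r) ⇓ y [ t ]
  ⇓stop : ∀ {σ τ} {p : Closed σ (σ ⊕ τ)} {x y t} →
          p ∙ x ⇓ inj₂ y [ t ] → loop p ∙ x ⇓ y [ t ]
  ⇓next : ∀ {σ τ} {p : Closed σ (σ ⊕ τ)} {x x′ y s t} →
          p ∙ x ⇓ inj₁ x′ [ s ] → loop p ∙ x′ ⇓ y [ t ] → loop p ∙ x ⇓ y [ s + t ]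

-- The computation of out x from the encoding inp x, for x ranging over X.
PolyTimeComputable : ∀ {X : Set} {σ τ} → (X → ⟦ σ ⟧) → (X → ⟦ τ ⟧) → Set
PolyTimeComputable {X} {σ} {τ} inp out =
  Σ[ p ∈ Closed σ τ ] Σ[ q ∈ Poly ]
    (∀ x → ∃[ t ] (p ∙ inp x ⇓ out x [ t ] × t ≤ eval q (size σ (inp x))))

-- A program with one unspecified subroutine of type σ → τ, and its
-- instantiation by an actual program.
data Hole (σ τ : Ty) : Ty → Ty → Set where
  hole : Hole σ τ σ τ

plug : ∀ {σ τ ρ υ} → Prog (Hole σ τ) ρ υ → Closed σ τ → Closed ρ υ
plug (call hole) P = P
plug (prim f)    P = prim f
plug (p ⨾ q)     P = plug p P ⨾ plug q P
plug (pair p q)  P = pair (plug p P) (plug q P)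
plug (case p q)  P = case (plug p P) (plug q P)
plug (cond p q)  P = cond (plug p P) (plug q P)
plug (loop p)    P = loop (plug p P)

-- Parallel edges and self-loops are allowed and the pair of endpoints is
-- listed in some order.  Restricted kinds of graph (simple, undirected, ...)
-- are the special case of a class of subgraphs that is empty on other graphs
-- and of objectives that ignore the order of endpoints.
record Graph : Set where
  field
    order : ℕ
    #edges : ℕ
    ends  : Vec (Fin order × Fin order) #edges

open Graph public

record Subgraph (G : Graph) : Set where
  field
    nodes : Subset (order G)
    edges : Subset (#edges G)
    .incident : ∀ {e} → e ∈ edges →
                proj₁ (lookup (ends G) e) ∈ nodes × proj₂ (lookup (ends G) e) ∈ nodes

open Subgraph public

-- Pure edge costs (node costs) have all node costs (edge costs) zero.
record Cost (G : Graph) : Set where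
  field
    nodeCost : Vec ℕ (order G)
    edgeCost : Vec ℕ (#edges G)

open Cost public

maxCost : ∀ {G} → Cost G → ℕ
maxCost c = Vec.foldr′ _⊔_ 0 (nodeCost c) ⊔ Vec.foldr′ _⊔_ 0 (edgeCost c)

record Network : Set where
  field
    graph : Graph
    c d   : Cost graph

open Network public

-- Each node is listed together with its two costs, so the
-- size of a network is at least its number of nodes.

networkTy subgraphTy solutionTy : Ty
networkTy  = list (nat ⊗ nat) ⊗ list ((nat ⊗ nat) ⊗ (nat ⊗ nat))
subgraphTy = list bool ⊗ list bool
solutionTy = unit ⊕ subgraphTy

encNetwork : Network → ⟦ networkTy ⟧
encNetwork N =
  Vec.toList (Vec.zip (nodeCost (c N)) (nodeCost (d N))) ,
  Vec.toList (Vec.zipWith (λ e w → (toℕ (proj₁ e) , toℕ (proj₂ e)) , w)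
                          (ends (graph N))
                          (Vec.zip (edgeCost (c N)) (edgeCost (d N))))

encSubgraph : ∀ {G} → Subgraph G → ⟦ subgraphTy ⟧
encSubgraph H = Vec.toList (nodes H) , Vec.toList (edges H)

encSolution : ∀ {G} → Maybe (Subgraph G) → ⟦ solutionTy ⟧
encSolution nothing  = inj₁ tt
encSolution (just H) = inj₂ (encSubgraph H)

Objective : Set
Objective = (G : Graph) → Cost G → Subgraph G → ℕ

SubgraphClass : Set₁
SubgraphClass = (G : Graph) → Subgraph G → Set

Value : Set
Value = (N : Network) → Subgraph (graph N) → ℕ

under-c under-d : Objective → Value
under-c A N = A (graph N) (c N)
under-d B N = B (graph N) (d N)

-- The budget bounds the first value; the second is to be minimised.
record Problem : Set₁ where
  constructor ⟨_,_,_⟩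
  field
    first second : Value
    class        : SubgraphClass

open Problem public

Feasible : Problem → (N : Network) → ℕ → Subgraph (graph N) → Set
Feasible Π N b H = class Π (graph N) H × first Π N H ≤ b

-- m is the minimum second value over all solutions within budget b.
IsMinimum : Problem → Network → ℕ → ℕ → Set
IsMinimum Π N b m =
  (∃[ H ] (Feasible Π N b H × second Π N H ≡ m)) ×
  (∀ H → Feasible Π N b H → m ≤ second Π N H)

-- One direction of hostility: lowering the budget on the first objective
-- never lowers the minimum of the second.  (It holds for every problem, since a
-- larger budget only admits more solutions.)
Monotone : Problem → Set
Monotone Π = ∀ N {b b′ m m′} → b ≤ b′ → IsMinimum Π N b m → IsMinimum Π N b′ m′ → m′ ≤ m

-- Performance ratios may depend on the instance.
Ratio : Set
Ratio = Network → ℚ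

infix 4 _≤[_]_

_≤[_]_ : ℕ → ℚ → ℕ → Set
k ≤[ r ] m = (ℤ.+ k) ℚ./ 1 ℚ.≤ r ℚ.* ((ℤ.+ m) ℚ./ 1)

-- An algorithm may answer "no solution" only if no solution meets the budget.
-- If none does, it may still return a solution with first value at most α
-- times the budget, the condition on the second value then being void.
Guarantee : ℚ → ℚ → (Π : Problem) (N : Network) → ℕ → Maybe (Subgraph (graph N)) → Set
Guarantee α β Π N b nothing  = ¬ (∃[ H ] Feasible Π N b H)
Guarantee α β Π N b (just H) =
  class Π (graph N) H ×
  first Π N H ≤[ α ] b ×
  (∀ m → IsMinimum Π N b m → second Π N H ≤[ β ] m)

record ApproximationAlgorithm (α β : Ratio) (Π : Problem) : Set where
  field
    program : Closed (networkTy ⊗ nat) solutionTy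
    time    : Poly
    correct : ∀ N b → ∃[ s ] ∃[ t ]
      ( program ∙ (encNetwork N , b) ⇓ encSolution s [ t ]
      × t ≤ eval time (size (networkTy ⊗ nat) (encNetwork N , b))
      × Guarantee (α N) (β N) Π N b s )

open ApproximationAlgorithm public

-- A uniform polynomial-time transformation: one fixed program T using the
-- given algorithm as a subroutine, with one fixed polynomial q bounding the
-- overhead.  On inputs of size s, the algorithm is in effect called at most
-- q s times, on inputs of size at most q s, with q s further work.  (As a map
-- on program texts, plug T is a substitution and so linear.)
PolyTimeTransformable : (α β : Ratio) (Π : Problem) (α′ β′ : Ratio) (Π′ : Problem) → Set
PolyTimeTransformable α β Π α′ β′ Π′ =
  Σ[ T ∈ Prog (Hole (networkTy ⊗ nat) solutionTy) (networkTy ⊗ nat) solutionTy ]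
  Σ[ q ∈ Poly ]
    ((P : ApproximationAlgorithm α β Π) →
     Σ[ P′ ∈ ApproximationAlgorithm α′ β′ Π′ ]
       ( program P′ ≡ plug T (program P)
       × (∀ s → eval (time P′) s ≤ eval q s * suc (eval (time P) (eval q s))) ))

PolyTimeValue : Value → Set
PolyTimeValue V =
  PolyTimeComputable {X = Σ[ N ∈ Network ] Subgraph (graph N)} {networkTy ⊗ subgraphTy} {nat}
    (λ (N , H) → encNetwork N , encSubgraph H)
    (λ (N , H) → V N H)

-- As numerator and denominator; only used for nonnegative ratios.
PolyTimeRatio : Ratio → Set
PolyTimeRatio r =
  PolyTimeComputable {X = Network} {networkTy} {nat ⊗ nat}
    encNetwork
    (λ N → ℤ.∣ ℚ.↥ (r N) ∣ , ℚ.↧ₙ (r N))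

constant-ratio : ∀ (r : ℚ) → PolyTimeRatio (λ _ → r)
constant-ratio r =
  pair (prim (lit ℤ.∣ ℚ.↥ r ∣)) (prim (lit (ℚ.↧ₙ r))) ,
  0 ∷ 2 ∷ [] ,
  λ N → _ , ⇓pair ⇓prim ⇓prim , ≤-reflexive (double (size networkTy (encNetwork N)))
  where
  double : ∀ n → n + n ≡ n * (2 + n * 0)
  double n rewrite *-zeroʳ n | *-comm n 2 | +-identityʳ n = refl

-- C-hi N D bounds the c-value of every solution within budget D, and is at
-- most a polynomial in the number of nodes times the largest c-cost.
BoundedBudget : Objective → Objective → SubgraphClass → Set
BoundedBudget A B S =
  Σ[ C-hi ∈ (Network → ℕ → ℕ) ] Σ[ p ∈ Poly ]
    ( (∀ N D H → S (graph N) H → under-d B N H ≤ D → under-c A N H ≤ C-hi N D)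
    × (∀ N D → C-hi N D ≤ eval p (order (graph N)) * maxCost (c N)) )

{-# OPTIONS --safe #-}

-- Binary search for a budget C on the first objective, with the given
-- algorithm as oracle: C is accepted if the answer H has B(H) ≤ β·D.  If C is
-- rejected, no solution has both A ≤ C and B ≤ D, since otherwise the
-- minimum of B within budget C would be at most D and the guarantee would give
-- B(H) ≤ β·D.  Acceptance need not be monotone in C, but the search ends at an
-- accepted C below which no solution within budget D lies, so the answer at C
-- has A-value at most α·C ≤ α·OPT.

module Submission where

open import Defs
open import Data.Bool using (Bool; true; false; if_then_else_; T)
open import Data.Bool.Properties using (if-float)
open import Data.Empty using (⊥-elim)
import Data.Integer as ℤ
import Data.Integer.Properties as ℤ
open import Data.List using (List; []; _∷_; map)
open import Data.Maybe using (Maybe; just; nothing; maybe′)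
open import Data.Nat
open import Data.Nat.Logarithm using (⌊log₂_⌋; ⌊log₂⌋-mono-≤; ⌊log₂[2^n]⌋≡n; ⌊log₂⌊n/2⌋⌋≡⌊log₂n⌋∸1)
open import Data.Nat.Properties
open import Data.Nat.Tactic.RingSolver using (solve-∀)
open import Data.Product using (∃-syntax; Σ-syntax; _×_; _,_; proj₁; proj₂)
open import Data.Rational as ℚ using (NonNegative; mkℚ)
import Data.Rational.Properties as ℚ
open import Data.Rational.Unnormalised as ℚᵘ using (mkℚᵘ; *≤*)
import Data.Rational.Unnormalised.Properties as ℚᵘ
open import Data.Sum using (_⊎_; inj₁; inj₂)
open import Data.Unit using (tt)
open import Data.Vec as Vec using (Vec; []; _∷_)
open import Data.Vec.Properties using (map-proj₁-zip)
import Function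
open import Relation.Binary.PropositionalEquality hiding ([_])
open import Relation.Nullary using (¬_; yes; no)

-- The budget hypothesis supplies `C-hi` as a mere function, with no program computing it. The
-- search therefore starts from a computable number, a product over the entries of the network,
-- which may exceed `C-hi` exponentially. This is harmless: the number of iterations is at most one
-- more than the number of binary digits of the starting width, and a product has at most as many
-- digits as its factors together.
--
-- A polynomial time bound for a loop body does not by itself survive iteration, since states could
-- grow from round to round. Here they cannot: the numbers in the state stay below the initial
-- width, and a stored answer is a pair of bit lists, one bit per node and edge, however long the
-- subroutine runs. All sizes are thus measured in multiples of the size of the initial state.
--
-- `Guarantee` bounds the second value only relative to a minimum. A rejection uses it just to reach
-- a contradiction, so existence of the minimum up to double negation is enough.

private
  variable
    σ σ′ τ ρ υ : Ty

-- Polynomials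

infixl 6 _⊞_
infixl 7 _⊠_
infixr 8 _⊚_

-- Opaque, so that bounds are compared through the `eval` laws alone and the large polynomials of
-- composed programs never unfold.
abstract

  _⊞_ : Poly → Poly → Poly
  []      ⊞ q       = q
  (a ∷ p) ⊞ []      = a ∷ p
  (a ∷ p) ⊞ (b ∷ q) = a + b ∷ p ⊞ q

  _⊠_ : Poly → Poly → Poly
  []      ⊠ q = []
  (a ∷ p) ⊠ q = map (a *_) q ⊞ (0 ∷ p ⊠ q)

  _⊚_ : Poly → Poly → Poly
  []      ⊚ q = []
  (a ∷ p) ⊚ q = (a ∷ []) ⊞ q ⊠ (p ⊚ q)

  constant : ℕ → Poly
  constant a = a ∷ []

  identity : Poly
  identity = 0 ∷ 1 ∷ []

  eval-constant : ∀ a x → eval (constant a) x ≡ a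
  eval-constant a x = trans (cong (a +_) (*-zeroʳ x)) (+-identityʳ a)

  eval-identity : ∀ x → eval identity x ≡ x
  eval-identity x = trans (cong (x *_) (eval-constant 1 x)) (*-identityʳ x)

  eval-⊞ : ∀ p q x → eval (p ⊞ q) x ≡ eval p x + eval q x
  eval-⊞ []      q       x = refl
  eval-⊞ (a ∷ p) []      x = sym (+-identityʳ _)
  eval-⊞ (a ∷ p) (b ∷ q) x rewrite eval-⊞ p q x = interchange a b x (eval p x) (eval q x)
    where
    interchange : ∀ a b x u v → a + b + x * (u + v) ≡ a + x * u + (b + x * v)
    interchange = solve-∀

  eval-scale : ∀ a q x → eval (map (a *_) q) x ≡ a * eval q x
  eval-scale a []      x = sym (*-zeroʳ a)
  eval-scale a (b ∷ q) x rewrite eval-scale a q x = distrib a b x (eval q x)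
    where
    distrib : ∀ a b x u → a * b + x * (a * u) ≡ a * (b + x * u)
    distrib = solve-∀

  eval-⊠ : ∀ p q x → eval (p ⊠ q) x ≡ eval p x * eval q x
  eval-⊠ []      q x = refl
  eval-⊠ (a ∷ p) q x
    rewrite eval-⊞ (map (a *_) q) (0 ∷ p ⊠ q) x | eval-scale a q x | eval-⊠ p q x
    = distrib a x (eval p x) (eval q x)
    where
    distrib : ∀ a x u v → a * v + x * (u * v) ≡ (a + x * u) * v
    distrib = solve-∀

  eval-⊚ : ∀ p q x → eval (p ⊚ q) x ≡ eval p (eval q x)
  eval-⊚ []      q x = refl
  eval-⊚ (a ∷ p) q x
    rewrite eval-⊞ (constant a) (q ⊠ (p ⊚ q)) x | eval-constant a x | eval-⊠ q (p ⊚ q) x | eval-⊚ p q x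
    = refl

eval-mono : ∀ p {x y} → x ≤ y → eval p x ≤ eval p y
eval-mono []      x≤y = z≤n
eval-mono (a ∷ p) x≤y = +-monoʳ-≤ a (*-mono-≤ x≤y (eval-mono p x≤y))

-- Sizes of values and of outputs

n<2^size : ∀ n → n < 2 ^ size nat n
n<2^size n with n <? 2 ^ suc ⌊log₂ n ⌋
... | yes n<2^ = n<2^
... | no n≮2^ = ⊥-elim (<-irrefl refl (subst (_≤ ⌊log₂ n ⌋) (⌊log₂[2^n]⌋≡n _) (⌊log₂⌋-mono-≤ (≮⇒≥ n≮2^))))

half-< : ∀ {n m} → n < m + m → ⌊ n /2⌋ < m
half-< {n} {m} n<2m = ≰⇒> λ m≤half → <⇒≱ n<2m (begin
  m + m                   ≤⟨ +-mono-≤ m≤half (≤-trans m≤half (⌊n/2⌋≤⌈n/2⌉ n)) ⟩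
  ⌊ n /2⌋ + ⌈ n /2⌉       ≡⟨ ⌊n/2⌋+⌈n/2⌉≡n n ⟩
  n                       ∎)
  where open ≤-Reasoning

2^-double : ∀ k → 2 ^ suc k ≡ 2 ^ k + 2 ^ k
2^-double k = cong (2 ^ k +_) (+-identityʳ (2 ^ k))

-- Induction on k by halving: dropping the last binary digit lowers the logarithm by one.
size-nat-≤ : ∀ k {n} → n < 2 ^ suc k → size nat n ≤ suc k
size-nat-≤ zero    {0}     n<2 = s≤s z≤n
size-nat-≤ zero    {1}     n<2 = s≤s z≤n
size-nat-≤ zero    {2+ n}  (s≤s (s≤s ()))
size-nat-≤ (suc k) {n}     n<2^ =
  s≤s (≤-trans (m≤n+m∸n ⌊log₂ n ⌋ 1)
    (s≤s (subst (_≤ k) (⌊log₂⌊n/2⌋⌋≡⌊log₂n⌋∸1 n)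
      (s≤s⁻¹ (size-nat-≤ k (half-< (subst (n <_) (2^-double (suc k)) n<2^)))))))

size-nat-mono : ∀ {m n} → m ≤ n → size nat m ≤ size nat n
size-nat-mono m≤n = s≤s (⌊log₂⌋-mono-≤ m≤n)

1≤size : ∀ σ (x : ⟦ σ ⟧) → 1 ≤ size σ x
1≤size unit     _        = ≤-refl
1≤size bool     _        = ≤-refl
1≤size nat      _        = s≤s z≤n
1≤size (σ ⊗ τ)  _        = s≤s z≤n
1≤size (σ ⊕ τ)  (inj₁ _) = s≤s z≤n
1≤size (σ ⊕ τ)  (inj₂ _) = s≤s z≤n
1≤size (list σ) []       = ≤-refl
1≤size (list σ) (_ ∷ _)  = s≤s z≤n

size-* : ∀ m n → size nat (m * n) ≤ size nat m + size nat n
size-* m n = size-nat-≤ (⌊log₂ m ⌋ + size nat n)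
  (subst (m * n <_) (sym (^-distribˡ-+-* 2 (size nat m) (size nat n)))
    (*-mono-< (n<2^size m) (n<2^size n)))

-- Every number has at least one digit, so both powers of two are at least 2, and then their sum is
-- at most their product.
size-+ : ∀ m n → size nat (m + n) ≤ size nat m + size nat n
size-+ m n = size-nat-≤ (⌊log₂ m ⌋ + size nat n)
  (subst (m + n <_) (sym (^-distribˡ-+-* 2 (size nat m) (size nat n))) (<-≤-trans
    (+-mono-<-≤ (n<2^size m) (<⇒≤ (n<2^size n)))
    (sum≤product (2≤2^ ⌊log₂ m ⌋) (2≤2^ ⌊log₂ n ⌋))))
  where
  2≤2^ : ∀ k → 2 ≤ 2 ^ suc k
  2≤2^ k = ^-monoʳ-≤ 2 {1} {suc k} (s≤s z≤n)

  sum≤product : ∀ {a b} → 2 ≤ a → 2 ≤ b → a + b ≤ a * b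
  sum≤product {2+ a} {2+ b} _ _ = subst (2+ a + 2+ b ≤_) (expand a b) (m≤m+n (2+ a + 2+ b) (a + b + a * b))
    where
    expand : ∀ a b → 2 + a + (2 + b) + (a + b + a * b) ≡ (2 + a) * (2 + b)
    expand = solve-∀
  sum≤product {1} (s≤s ()) _
  sum≤product {2+ a} {1} _ (s≤s ())

-- A program enlarges its input at most in proportion to its running time, so
-- that polynomial time composes.
prim-growth : Prim σ τ → ℕ
prim-growth inl     = 2
prim-growth inr     = 2
prim-growth uncons  = 2
prim-growth (lit n) = size nat n
prim-growth _       = 1

size-prim : ∀ (f : Prim σ τ) x → size τ (⟦ f ⟧ₚ x) ≤ prim-growth f * size σ x
size-prim {σ} f x = go f x
  where
  ≤1* : ∀ {m n} → m ≤ n → m ≤ 1 * n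
  ≤1* = subst (_ ≤_) (sym (*-identityˡ _))

  suc≤2* : ∀ {n} → 1 ≤ n → suc n ≤ 2 * n
  suc≤2* {n} 1≤n = ≤-trans (+-monoˡ-≤ n 1≤n) (+-monoʳ-≤ n (≤1* ≤-refl))

  go : ∀ {σ τ} (f : Prim σ τ) x → size τ (⟦ f ⟧ₚ x) ≤ prim-growth f * size σ x
  go id      x            = ≤1* ≤-refl
  go !       x            = ≤1* (1≤size _ x)
  go fst     (x , y)      = ≤1* (m≤n⇒m≤1+n (m≤m+n _ _))
  go snd     (x , y)      = ≤1* (m≤n⇒m≤1+n (m≤n+m _ _))
  go inl     x            = suc≤2* (1≤size _ x)
  go inr     x            = suc≤2* (1≤size _ x)
  go (bit b) x            = ≤1* (1≤size _ x)
  go {σ} (lit n) x        = m≤m*n (size nat n) (size σ x) {{>-nonZero (1≤size σ x)}}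
  go nil     x            = ≤1* (1≤size _ x)
  go cons    (x , xs)     = ≤1* ≤-refl
  go uncons  []           = ≤-refl
  go uncons  (x ∷ xs)     = suc≤2* (s≤s z≤n)
  go add     (m , n)      = ≤1* (m≤n⇒m≤1+n (size-+ m n))
  go monus   (m , n)      = ≤1* (m≤n⇒m≤1+n (≤-trans (size-nat-mono (m∸n≤m m n)) (m≤m+n _ _)))
  go mul     (m , n)      = ≤1* (m≤n⇒m≤1+n (size-* m n))
  go half    n            = ≤1* (size-nat-mono (⌊n/2⌋≤n n))
  go leq     (m , n)      = ≤1* (s≤s z≤n)

-- For a composition only the last program counts, because its own running time, part of the total,
-- already bounds its output. The `suc` for `pair` is the cell of the pair itself, paid for by the
-- fact that every run takes time at least 1.
growth : Closed σ τ → ℕ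
growth (prim f)   = prim-growth f
growth (p ⨾ q)    = growth q
growth (pair p q) = suc (growth p + growth q)
growth (case p q) = growth p + growth q
growth (cond p q) = growth p + growth q
growth (loop p)   = growth p

1≤time : ∀ {p : Closed σ τ} {x y t} → p ∙ x ⇓ y [ t ] → 1 ≤ t
1≤time ⇓prim       = 1≤size _ _
1≤time (⇓⨾ r _)    = ≤-trans (1≤time r) (m≤m+n _ _)
1≤time (⇓pair r _) = ≤-trans (1≤time r) (m≤m+n _ _)
1≤time (⇓inj₁ r)   = 1≤time r
1≤time (⇓inj₂ r)   = 1≤time r
1≤time (⇓true r)   = 1≤time r
1≤time (⇓false r)  = 1≤time r
1≤time (⇓stop r)   = 1≤time r
1≤time (⇓next r _) = ≤-trans (1≤time r) (m≤m+n _ _)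

size-output : ∀ {p : Closed σ τ} {x y t} → p ∙ x ⇓ y [ t ] → size τ y ≤ growth p * t
size-output (⇓prim {f = f} {x}) = size-prim f x
size-output {p = _ ⨾ q} (⇓⨾ {s = s} {t} _ r) =
  ≤-trans (size-output r) (*-monoʳ-≤ (growth q) (m≤n+m t s))
size-output {p = pair p q} (⇓pair {y = y} {z} {s} {t} r r′) = begin
  suc (size _ y + size _ z)                              ≤⟨ s≤s (+-mono-≤ (size-output r) (size-output r′)) ⟩
  1 + (growth p * s + growth q * t)                      ≤⟨ +-mono-≤ (≤-trans (1≤time r) (m≤m+n s t)) (+-mono-≤
                                                              (*-monoʳ-≤ (growth p) (m≤m+n s t))
                                                              (*-monoʳ-≤ (growth q) (m≤n+m t s))) ⟩
  (s + t) + (growth p * (s + t) + growth q * (s + t))    ≡⟨ cong (s + t +_) (*-distribʳ-+ (s + t) (growth p) (growth q)) ⟨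
  suc (growth p + growth q) * (s + t)                    ∎
  where open ≤-Reasoning
size-output {p = case p q} (⇓inj₁ {t = t} r) =
  ≤-trans (size-output r) (*-monoˡ-≤ t (m≤m+n (growth p) (growth q)))
size-output {p = case p q} (⇓inj₂ {t = t} r) =
  ≤-trans (size-output r) (*-monoˡ-≤ t (m≤n+m (growth q) (growth p)))
size-output {p = cond p q} (⇓true {t = t} r) =
  ≤-trans (size-output r) (*-monoˡ-≤ t (m≤m+n (growth p) (growth q)))
size-output {p = cond p q} (⇓false {t = t} r) =
  ≤-trans (size-output r) (*-monoˡ-≤ t (m≤n+m (growth q) (growth p)))
size-output (⇓stop r) = ≤-trans (n≤1+n _) (size-output r)
size-output {p = loop p} (⇓next {s = s} {t} _ r) =
  ≤-trans (size-output r) (*-monoʳ-≤ (growth p) (m≤n+m t s))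

≤-⊞ˡ : ∀ p q {t m n} → t ≤ eval p m → m ≤ n → t ≤ eval (p ⊞ q) n
≤-⊞ˡ p q {n = n} t≤ m≤n = ≤-trans t≤ (≤-trans (eval-mono p m≤n)
  (subst (eval p n ≤_) (sym (eval-⊞ p q n)) (m≤m+n _ _)))

≤-⊞ʳ : ∀ p q {t m n} → t ≤ eval q m → m ≤ n → t ≤ eval (p ⊞ q) n
≤-⊞ʳ p q {n = n} t≤ m≤n = ≤-trans t≤ (≤-trans (eval-mono q m≤n)
  (subst (eval q n ≤_) (sym (eval-⊞ p q n)) (m≤n+m _ _)))

-- Polynomial-time functions

-- `PolyTimeComputable` as a record. Inputs and outputs are indexed by `X`, so a program need only
-- be right on encodings, and a whole pipeline can be described by functions on networks and
-- subgraphs.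
record PolyTime {X : Set} {σ τ} (inp : X → ⟦ σ ⟧) (out : X → ⟦ τ ⟧) : Set where
  constructor polyTime
  field
    code  : Closed σ τ
    bound : Poly
    runs  : ∀ x → ∃[ t ] (code ∙ inp x ⇓ out x [ t ] × t ≤ eval bound (size σ (inp x)))

open PolyTime

abstract

  along : ∀ {X Y : Set} {h : X → Y} {inp : Y → ⟦ σ ⟧} {out : Y → ⟦ τ ⟧} →
          PolyTime inp out → PolyTime (λ x → inp (h x)) (λ x → out (h x))
  along {h = h} P = polyTime (code P) (bound P) (λ x → runs P (h x))

  module _ {X : Set} where

    apply : ∀ (f : Prim σ τ) {inp : X → ⟦ σ ⟧} → PolyTime inp (λ x → ⟦ f ⟧ₚ (inp x))
    apply f = polyTime (prim f) identity λ x → _ , ⇓prim , ≤-reflexive (sym (eval-identity _))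

    infixl 9 _▸_
    infixr 8 _▵_

    _▸_ : ∀ {inp : X → ⟦ ρ ⟧} {mid : X → ⟦ σ ⟧} {out : X → ⟦ τ ⟧} →
          PolyTime inp mid → PolyTime mid out → PolyTime inp out
    _▸_ {ρ} {σ} {inp = inp} {mid} P Q = polyTime (code P ⨾ code Q)
      (bound P ⊞ bound Q ⊚ (constant (growth (code P)) ⊠ bound P))
      λ x → let (s , r , s≤) = runs P x ; (t , r′ , t≤) = runs Q x
                n = size ρ (inp x) ; g = growth (code P)
                size-mid = begin
                  size σ (mid x)                          ≤⟨ size-output r ⟩
                  g * s                                   ≤⟨ *-monoʳ-≤ g s≤ ⟩
                  g * eval (bound P) n                    ≡⟨ cong (_* eval (bound P) n) (eval-constant g n) ⟨
                  eval (constant g) n * eval (bound P) n  ≡⟨ eval-⊠ (constant g) (bound P) n ⟨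
                  eval (constant g ⊠ bound P) n           ∎
            in s + t , ⇓⨾ r r′ , (begin
                 s + t
                   ≤⟨ +-mono-≤ s≤ (≤-trans t≤ (eval-mono (bound Q) size-mid)) ⟩
                 eval (bound P) n + eval (bound Q) (eval (constant g ⊠ bound P) n)
                   ≡⟨ cong (eval (bound P) n +_) (eval-⊚ (bound Q) (constant g ⊠ bound P) n) ⟨
                 eval (bound P) n + eval (bound Q ⊚ (constant g ⊠ bound P)) n
                   ≡⟨ eval-⊞ (bound P) _ n ⟨
                 eval (bound P ⊞ bound Q ⊚ (constant g ⊠ bound P)) n ∎)
      where open ≤-Reasoning

    _▵_ : ∀ {inp : X → ⟦ ρ ⟧} {f : X → ⟦ σ ⟧} {g : X → ⟦ τ ⟧} →
          PolyTime inp f → PolyTime inp g → PolyTime inp (λ x → f x , g x)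
    P ▵ Q = polyTime (pair (code P) (code Q)) (bound P ⊞ bound Q)
      λ x → let (s , r , s≤) = runs P x ; (t , r′ , t≤) = runs Q x
            in s + t , ⇓pair r r′ , subst (s + t ≤_) (sym (eval-⊞ (bound P) (bound Q) _)) (+-mono-≤ s≤ t≤)

    branch : ∀ {inp : X → ⟦ ρ ⟧} {f g : X → ⟦ τ ⟧} (b : X → Bool) →
             PolyTime inp f → PolyTime inp g →
             PolyTime (λ x → b x , inp x) (λ x → if b x then f x else g x)
    branch {ρ} {τ} {inp = inp} {f} {g} b P Q = polyTime (cond (code P) (code Q)) (bound P ⊞ bound Q) λ x → by x (b x)
      where
      larger : ∀ n → n ≤ suc (1 + n)
      larger n = m≤n+m n 2

      by : ∀ x c → ∃[ t ] (cond (code P) (code Q) ∙ (c , inp x) ⇓ (if c then f x else g x) [ t ]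
                          × t ≤ eval (bound P ⊞ bound Q) (size (bool ⊗ ρ) (c , inp x)))
      by x true  = let (t , r , t≤) = runs P x in t , ⇓true r , ≤-⊞ˡ (bound P) (bound Q) t≤ (larger _)
      by x false = let (t , r , t≤) = runs Q x in t , ⇓false r , ≤-⊞ʳ (bound P) (bound Q) t≤ (larger _)

abstract

  -- The branches have index sets of their own because `nothing` and `just H` carry different data;
  -- `cover` tells which branch an input belongs to.
  branch-⊎ : ∀ {X Y Z : Set} {inp : X → ⟦ (σ ⊕ σ′) ⊗ ρ ⟧} {out : X → ⟦ τ ⟧}
             {f : Y → ⟦ σ ⊗ ρ ⟧} {g : Y → ⟦ τ ⟧} {f′ : Z → ⟦ σ′ ⊗ ρ ⟧} {g′ : Z → ⟦ τ ⟧} →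
             PolyTime f g → PolyTime f′ g′ →
             (∀ x → (∃[ y ] (inp x ≡ (inj₁ (proj₁ (f y)) , proj₂ (f y)) × out x ≡ g y)) ⊎
                    (∃[ z ] (inp x ≡ (inj₂ (proj₁ (f′ z)) , proj₂ (f′ z)) × out x ≡ g′ z))) →
             PolyTime inp out
  branch-⊎ {σ} {σ′} {ρ} {inp = inp} {out} P Q cover =
    polyTime (case (code P) (code Q)) (bound P ⊞ bound Q) runs′
    where
    runs′ : ∀ x → ∃[ t ] (case (code P) (code Q) ∙ inp x ⇓ out x [ t ]
                        × t ≤ eval (bound P ⊞ bound Q) (size ((σ ⊕ σ′) ⊗ ρ) (inp x)))
    runs′ x with inp x | out x | cover x
    ... | _ | _ | inj₁ (y , refl , refl) =
      let (t , r , t≤) = runs P y in t , ⇓inj₁ r , ≤-⊞ˡ (bound P) (bound Q) t≤ (n≤1+n (suc (size _ _ + size ρ _)))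
    ... | _ | _ | inj₂ (z , refl , refl) =
      let (t , r , t≤) = runs Q z in t , ⇓inj₂ r , ≤-⊞ʳ (bound P) (bound Q) t≤ (n≤1+n (suc (size _ _ + size ρ _)))

-- An upper bound for the budget

module Product (weight : ⟦ τ ⟧ → ℕ) (weight-polyTime : PolyTime {⟦ τ ⟧} {τ} {nat} Function.id weight)
               (L : ℕ) (size-weight : ∀ x → size nat (weight x) ≤ L * size τ x) where

  product : ℕ → List ⟦ τ ⟧ → ℕ
  product acc []       = acc
  product acc (x ∷ xs) = product (acc * weight x) xs

  step : ℕ × List ⟦ τ ⟧ → ⟦ (nat ⊗ list τ) ⊕ nat ⟧
  step (acc , [])     = inj₂ acc
  step (acc , x ∷ xs) = inj₁ (acc * weight x , xs)

  abstract

    step-polyTime : PolyTime {ℕ × List ⟦ τ ⟧} {nat ⊗ list τ} {(nat ⊗ list τ) ⊕ nat} Function.id step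
    step-polyTime = (apply snd ▸ apply uncons ▵ apply fst) ▸ branch-⊎ exit continue
      λ { (acc , [])     → inj₁ (acc , refl , refl)
        ; (acc , x ∷ xs) → inj₂ ((acc , x , xs) , refl , refl) }
      where
      exit : PolyTime {ℕ} {unit ⊗ nat} {(nat ⊗ list τ) ⊕ nat} (λ acc → tt , acc) inj₂
      exit = apply snd ▸ apply inr

      continue : PolyTime {ℕ × ⟦ τ ⟧ × List ⟦ τ ⟧} {(τ ⊗ list τ) ⊗ nat} {(nat ⊗ list τ) ⊕ nat}
                   (λ (acc , x , xs) → (x , xs) , acc) (λ (acc , x , xs) → inj₁ (acc * weight x , xs))
      continue =
        ((apply snd ▵ apply fst ▸ apply fst ▸ along weight-polyTime) ▸ apply mul ▵ apply fst ▸ apply snd) ▸ apply inl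

  -- size acc + (1 + L) * size xs is a potential: it bounds the size of the
  -- loop state and never increases.
  step-size-decreases : ∀ acc x xs → size nat (acc * weight x) + suc L * size (list τ) xs ≤
                                     size nat acc + suc L * size (list τ) (x ∷ xs)
  step-size-decreases acc x xs = begin
    size nat (acc * weight x) + suc L * size (list τ) xs
      ≤⟨ +-monoˡ-≤ _ (≤-trans (size-* acc (weight x)) (+-monoʳ-≤ (size nat acc) (size-weight x))) ⟩
    size nat acc + L * size τ x + suc L * size (list τ) xs
      ≤⟨ m≤m+n _ (size τ x + suc L) ⟩
    size nat acc + L * size τ x + suc L * size (list τ) xs + (size τ x + suc L)
      ≡⟨ collect (size nat acc) L (size τ x) (size (list τ) xs) ⟩
    size nat acc + suc L * size (list τ) (x ∷ xs) ∎
    where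
    open ≤-Reasoning
    collect : ∀ a l s u → a + l * s + (1 + l) * u + (s + (1 + l)) ≡ a + (1 + l) * (1 + (s + u))
    collect = solve-∀

  initial-potential : ∀ acc xs → suc (size nat acc + suc L * size (list τ) xs) ≤ suc L * size (nat ⊗ list τ) (acc , xs)
  initial-potential acc xs = begin
    suc (size nat acc + suc L * size (list τ) xs)
      ≤⟨ +-mono-≤ {1} {suc L} (s≤s z≤n) (+-monoˡ-≤ _ (m≤n*m (size nat acc) (suc L))) ⟩
    suc L + (suc L * size nat acc + suc L * size (list τ) xs)
      ≡⟨ collect L (size nat acc) (size (list τ) xs) ⟩
    suc L * size (nat ⊗ list τ) (acc , xs) ∎
    where
    open ≤-Reasoning
    collect : ∀ l a s → 1 + l + ((1 + l) * a + (1 + l) * s) ≡ (1 + l) * (1 + (a + s))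
    collect = solve-∀

  -- The potential keeps every state size below the fixed `M`, so each iteration costs at most
  -- `eval (bound S) M`. The list size bounds the number of iterations, exit included, since `[]`
  -- has size 1.
  product-runs : (S : PolyTime {ℕ × List ⟦ τ ⟧} {nat ⊗ list τ} {(nat ⊗ list τ) ⊕ nat} Function.id step) →
                 ∀ acc xs M → suc (size nat acc + suc L * size (list τ) xs) ≤ M →
                 ∃[ t ] (loop (code S) ∙ (acc , xs) ⇓ product acc xs [ t ]
                        × t ≤ size (list τ) xs * eval (bound S) M)
  product-runs S acc [] M potential =
    let (t , r , t≤) = runs S (acc , [])
    in t , ⇓stop r , ≤-trans t≤ (≤-trans
      (eval-mono (bound S) (≤-trans (s≤s (+-monoʳ-≤ (size nat acc) (s≤s z≤n))) potential))
      (≤-reflexive (sym (+-identityʳ _))))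
  product-runs S acc (x ∷ xs) M potential =
    let (s , r , s≤) = runs S (acc , x ∷ xs)
        (t , r′ , t≤) = product-runs S (acc * weight x) xs M (≤-trans (s≤s (step-size-decreases acc x xs)) potential)
    in s + t , ⇓next r r′ , +-mono-≤
         (≤-trans s≤ (eval-mono (bound S)
           (≤-trans (s≤s (+-monoʳ-≤ (size nat acc) (m≤m+n _ _))) potential)))
         (≤-trans t≤ (*-monoˡ-≤ _ (m≤n+m (size (list τ) xs) (size τ x))))

  product-polyTime : PolyTime {ℕ × List ⟦ τ ⟧} {nat ⊗ list τ} {nat} Function.id (λ (acc , xs) → product acc xs)
  product-polyTime = polyTime (loop (code step-polyTime)) (identity ⊠ B ⊚ (constant (suc L) ⊠ identity)) runs′
    where
    open ≤-Reasoning
    B = bound step-polyTime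

    eval-bound : ∀ n → eval (identity ⊠ B ⊚ (constant (suc L) ⊠ identity)) n ≡ n * eval B (suc L * n)
    eval-bound n = trans (eval-⊠ identity _ n) (cong₂ _*_ (eval-identity n)
      (trans (eval-⊚ B _ n) (cong (eval B) (trans (eval-⊠ (constant (suc L)) identity n)
        (cong₂ _*_ (eval-constant (suc L) n) (eval-identity n))))))

    runs′ : ∀ ((acc , xs) : ℕ × List ⟦ τ ⟧) → ∃[ t ]
            (loop (code step-polyTime) ∙ (acc , xs) ⇓ product acc xs [ t ]
            × t ≤ eval (identity ⊠ B ⊚ (constant (suc L) ⊠ identity)) (size (nat ⊗ list τ) (acc , xs)))
    runs′ (acc , xs) =
      let (t , r , t≤) = product-runs step-polyTime acc xs _ (initial-potential acc xs)
      in t , r , ≤-trans t≤ (time-≤ acc xs)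
      where
      time-≤ : ∀ acc xs → size (list τ) xs * eval B (suc L * size (nat ⊗ list τ) (acc , xs)) ≤
               eval (identity ⊠ B ⊚ (constant (suc L) ⊠ identity)) (size (nat ⊗ list τ) (acc , xs))
      time-≤ acc xs = begin
        size (list τ) xs * eval B (suc L * n)   ≤⟨ *-monoˡ-≤ _ (m≤n⇒m≤1+n (m≤n+m (size (list τ) xs) (size nat acc))) ⟩
        n * eval B (suc L * n)                  ≡⟨ eval-bound n ⟨
        eval (identity ⊠ B ⊚ (constant (suc L) ⊠ identity)) n ∎
        where n = size (nat ⊗ list τ) (acc , xs)

module CostProduct (b : ℕ) (cost : ⟦ τ ⟧ → ℕ) (cost-polyTime : PolyTime {⟦ τ ⟧} {τ} {nat} Function.id cost)
                   (size-cost : ∀ x → size nat (cost x) ≤ size τ x) where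

  -- The added 1 keeps entries of cost zero from annihilating the product; the factor `b` yields an
  -- exponential in the number of entries.
  weight : ⟦ τ ⟧ → ℕ
  weight x = b * (1 + cost x)

  weight-polyTime : PolyTime {⟦ τ ⟧} {τ} {nat} Function.id weight
  weight-polyTime = (apply (lit b) ▵ (apply (lit 1) ▵ cost-polyTime) ▸ apply add) ▸ apply mul

  size-weight : ∀ x → size nat (weight x) ≤ (2 + size nat b) * size τ x
  size-weight x = begin
    size nat (b * (1 + cost x))               ≤⟨ size-* b (1 + cost x) ⟩
    size nat b + size nat (1 + cost x)        ≤⟨ +-monoʳ-≤ (size nat b) (size-+ 1 (cost x)) ⟩
    size nat b + (1 + size nat (cost x))      ≤⟨ +-mono-≤ (m≤m*n (size nat b) (size τ x) {{>-nonZero (1≤size τ x)}})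
                                                   (+-mono-≤ (1≤size τ x) (size-cost x)) ⟩
    size nat b * size τ x + (size τ x + size τ x)   ≡⟨ collect (size nat b) (size τ x) ⟩
    (2 + size nat b) * size τ x                     ∎
    where
    open ≤-Reasoning
    collect : ∀ b s → b * s + (s + s) ≡ (2 + b) * s
    collect = solve-∀

  open Product weight weight-polyTime (2 + size nat b) size-weight public

  -- All factors of the form 1 + cost are positive, so their product dominates the largest: 1 +
  -- max(x, m) ≤ (1 + x)(1 + m).
  product-≥ : ∀ {n} acc (xs : Vec ⟦ τ ⟧ n) →
              acc * (b ^ n * suc (Vec.foldr′ _⊔_ 0 (Vec.map cost xs))) ≤ product acc (Vec.toList xs)
  product-≥ acc []       = ≤-reflexive (*-identityʳ acc)
  product-≥ {suc n} acc (x ∷ xs) = begin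
    acc * (b * b ^ n * suc (cost x ⊔ m))        ≤⟨ *-monoʳ-≤ acc (*-monoʳ-≤ (b * b ^ n) (s≤s (m⊔n≤m+n (cost x) m))) ⟩
    acc * (b * b ^ n * suc (cost x + m))        ≤⟨ *-monoʳ-≤ acc (*-monoʳ-≤ (b * b ^ n) (m≤m+n (suc (cost x + m)) (cost x * m))) ⟩
    acc * (b * b ^ n * suc (cost x + m + cost x * m))  ≡⟨ collect acc b (b ^ n) (cost x) m ⟩
    acc * weight x * (b ^ n * suc m)            ≤⟨ product-≥ (acc * weight x) xs ⟩
    product (acc * weight x) (Vec.toList xs)    ∎
    where
    open ≤-Reasoning
    m = Vec.foldr′ _⊔_ 0 (Vec.map cost xs)
    collect : ∀ a b c x m → a * (b * c * (1 + (x + m + x * m))) ≡ a * (b * (1 + x)) * (c * (1 + m))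
    collect = solve-∀

-- Since x ≤ 2 ^ x, a polynomial at x is at most scale * base ^ x.
scale base : Poly → ℕ
scale []      = 0
scale (a ∷ p) = a + scale p
base []       = 1
base (a ∷ p)  = 2 * base p

base-nonZero : ∀ p → NonZero (base p)
base-nonZero []      = _
base-nonZero (a ∷ p) = m*n≢0 2 (base p) {{_}} {{base-nonZero p}}

n≤2^n : ∀ n → n ≤ 2 ^ n
n≤2^n zero    = z≤n
n≤2^n (suc n) = +-mono-≤ (m^n>0 2 n) (≤-trans (n≤2^n n) (m≤m+n _ _))

^-distribʳ : ∀ a b n → (a * b) ^ n ≡ a ^ n * b ^ n
^-distribʳ a b zero    = refl
^-distribʳ a b (suc n) rewrite ^-distribʳ a b n = interchange a b (a ^ n) (b ^ n)
  where
  interchange : ∀ a b c d → a * b * (c * d) ≡ a * c * (b * d)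
  interchange = solve-∀

eval-≤-exponential : ∀ p n → eval p n ≤ scale p * base p ^ n
eval-≤-exponential []      n = z≤n
eval-≤-exponential (a ∷ p) n = begin
  a + n * eval p n                              ≤⟨ +-mono-≤ (m≤m*n a (base (a ∷ p) ^ n) {{m^n≢0 (base (a ∷ p)) n {{base-nonZero (a ∷ p)}}}})
                                                     (*-mono-≤ (n≤2^n n) (eval-≤-exponential p n)) ⟩
  a * base (a ∷ p) ^ n + 2 ^ n * (scale p * base p ^ n)   ≡⟨ cong (a * base (a ∷ p) ^ n +_) (rearrange (2 ^ n) (scale p) (base p ^ n)) ⟩
  a * base (a ∷ p) ^ n + scale p * (2 ^ n * base p ^ n)   ≡⟨ cong (λ e → a * base (a ∷ p) ^ n + scale p * e) (^-distribʳ 2 (base p) n) ⟨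
  a * base (a ∷ p) ^ n + scale p * base (a ∷ p) ^ n       ≡⟨ *-distribʳ-+ (base (a ∷ p) ^ n) a (scale p) ⟨
  (a + scale p) * base (a ∷ p) ^ n                        ∎
  where
  open ≤-Reasoning
  rearrange : ∀ a b c → a * (b * c) ≡ b * (a * c)
  rearrange = solve-∀

module Nodes (b : ℕ) =
  CostProduct {nat ⊗ nat} b proj₁ (apply fst) (λ (x , y) → m≤n⇒m≤1+n (m≤m+n (size nat x) (size nat y)))
module Edges (b : ℕ) =
  CostProduct {(nat ⊗ nat) ⊗ (nat ⊗ nat)} b (λ x → proj₁ (proj₂ x)) (apply snd ▸ apply fst)
    (λ (e , x , y) → m≤n⇒m≤1+n (≤-trans (m≤n⇒m≤1+n (m≤m+n (size nat x) (size nat y))) (m≤n+m _ (size (nat ⊗ nat) e))))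

module _ (p : Poly) where

  -- A product over the entries of the network has only linearly many digits,
  -- whereas computing p (number of nodes) * maxCost itself would need a
  -- separate size estimate.
  cost-bound : ⟦ networkTy ⟧ → ℕ
  cost-bound (ns , es) = Edges.product (base p) (Nodes.product (base p) (scale p) ns) es

  cost-bound-polyTime : PolyTime {⟦ networkTy ⟧} {networkTy} {nat} Function.id cost-bound
  cost-bound-polyTime =
    ((apply (lit (scale p)) ▵ apply fst) ▸ along (Nodes.product-polyTime (base p)) ▵ apply snd)
    ▸ along (Edges.product-polyTime (base p))

  edge-costs : ∀ {A : Set} {f : A → ℕ × ℕ} {m} (es : Vec A m) (cs ds : Vec ℕ m) →
               Vec.map (λ x → proj₁ (proj₂ x)) (Vec.zipWith (λ e w → f e , w) es (Vec.zip cs ds)) ≡ cs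
  edge-costs []       []       []       = refl
  edge-costs (_ ∷ es) (c ∷ cs) (_ ∷ ds) = cong (c ∷_) (edge-costs es cs ds)

  cost-bound-≥ : ∀ N → eval p (order (graph N)) * maxCost (c N) ≤ cost-bound (encNetwork N)
  cost-bound-≥ N = begin
    eval p n * (mn ⊔ me)    ≤⟨ *-mono-≤ (eval-≤-exponential p n) max-≤ ⟩
    -- The edge weights carry the factor `base p` too; being nonzero, it only enlarges the bound.
    scale p * base p ^ n * (suc mn * suc me)   ≤⟨ m≤m*n _ (base p ^ m) {{m^n≢0 (base p) m {{base-nonZero p}}}} ⟩
    scale p * base p ^ n * (suc mn * suc me) * base p ^ m   ≡⟨ rearrange (scale p) (base p ^ n) (suc mn) (suc me) (base p ^ m) ⟩
    scale p * (base p ^ n * suc mn) * (base p ^ m * suc me)  ≤⟨ *-monoˡ-≤ _ nodes-≥ ⟩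
    node-product * (base p ^ m * suc me)                     ≤⟨ edges-≥ ⟩
    cost-bound (encNetwork N)                                ∎
    where
    open ≤-Reasoning
    n = order (graph N)
    m = #edges (graph N)
    mn = Vec.foldr′ _⊔_ 0 (nodeCost (c N))
    me = Vec.foldr′ _⊔_ 0 (edgeCost (c N))
    node-product = Nodes.product (base p) (scale p) (proj₁ (encNetwork N))

    nodes-≥ : scale p * (base p ^ n * suc mn) ≤ node-product
    nodes-≥ = subst (λ cs → scale p * (base p ^ n * suc (Vec.foldr′ _⊔_ 0 cs)) ≤ node-product)
      (map-proj₁-zip (nodeCost (c N)) (nodeCost (d N)))
      (Nodes.product-≥ (base p) (scale p) (Vec.zip (nodeCost (c N)) (nodeCost (d N))))

    edges-≥ : node-product * (base p ^ m * suc me) ≤ cost-bound (encNetwork N)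
    edges-≥ = subst (λ cs → node-product * (base p ^ m * suc (Vec.foldr′ _⊔_ 0 cs)) ≤ cost-bound (encNetwork N))
      (edge-costs (ends (graph N)) (edgeCost (c N)) (edgeCost (d N)))
      (Edges.product-≥ (base p) node-product (Vec.zipWith _ (ends (graph N)) (Vec.zip (edgeCost (c N)) (edgeCost (d N)))))

    max-≤ : mn ⊔ me ≤ suc mn * suc me
    max-≤ = ≤-trans (m⊔n≤m+n mn me) (≤-trans (m≤m+n (mn + me) (1 + mn * me)) (≤-reflexive (expand mn me)))
      where
      expand : ∀ a b → a + b + (1 + a * b) ≡ (1 + a) * (1 + b)
      expand = solve-∀

    rearrange : ∀ s a u v b → s * a * (u * v) * b ≡ s * (a * u) * (b * v)
    rearrange = solve-∀

-- The search

lift : ∀ {C} → Closed σ τ → Prog C σ τ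
lift (prim f)   = prim f
lift (p ⨾ q)    = lift p ⨾ lift q
lift (pair p q) = pair (lift p) (lift q)
lift (case p q) = case (lift p) (lift q)
lift (cond p q) = cond (lift p) (lift q)
lift (loop p)   = loop (lift p)

-- Propositional only: on opaque code `plug` and `lift` do not reduce, so runs of the transformer
-- are transported along this equation.
plug-lift : (p : Closed ρ υ) (P : Closed σ τ) → plug (lift p) P ≡ p
plug-lift (prim f)   P = refl
plug-lift (p ⨾ q)    P = cong₂ _⨾_ (plug-lift p P) (plug-lift q P)
plug-lift (pair p q) P = cong₂ pair (plug-lift p P) (plug-lift q P)
plug-lift (case p q) P = cong₂ case (plug-lift p P) (plug-lift q P)
plug-lift (cond p q) P = cong₂ cond (plug-lift p P) (plug-lift q P)
plug-lift (loop p)   P = cong loop (plug-lift p P)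

size-bools-≤ : ∀ {n} (bs : Vec Bool n) (xs : Vec ⟦ σ ⟧ n) →
               size (list bool) (Vec.toList bs) ≤ size (list σ) (Vec.toList xs)
size-bools-≤ []       []       = ≤-refl
size-bools-≤ {σ} (b ∷ bs) (x ∷ xs) = s≤s (+-mono-≤ (1≤size σ x) (size-bools-≤ bs xs))

-- Each bit of a subgraph is charged to the entry of its node or edge in the network, independently
-- of the program that produced the subgraph.
size-encSolution : ∀ N (s : Maybe (Subgraph (graph N))) →
                   size solutionTy (encSolution s) ≤ suc (size networkTy (encNetwork N))
size-encSolution N nothing  = s≤s (s≤s z≤n)
size-encSolution N (just H) = s≤s (s≤s (+-mono-≤
  (size-bools-≤ (nodes H) (Vec.zip (nodeCost (c N)) (nodeCost (d N))))
  (size-bools-≤ (edges H) (Vec.zipWith _ (ends (graph N)) (Vec.zip (edgeCost (c N)) (edgeCost (d N)))))))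

-- Rational ratios as inequalities between natural numbers

fraction : ∀ k → ℚ.toℚᵘ ((ℤ.+ k) ℚ./ 1) ℚᵘ.≃ mkℚᵘ (ℤ.+ k) 0
fraction k = ℚ.toℚᵘ-fromℚᵘ (mkℚᵘ (ℤ.+ k) 0)

scaled-fraction : ∀ r m → ℚ.toℚᵘ (r ℚ.* ((ℤ.+ m) ℚ./ 1)) ℚᵘ.≃ ℚ.toℚᵘ r ℚᵘ.* mkℚᵘ (ℤ.+ m) 0
scaled-fraction r m = ℚᵘ.≃-trans (ℚ.toℚᵘ-homo-* r _) (ℚᵘ.*-congˡ {ℚ.toℚᵘ r} (fraction m))

-- The cross-multiplied form is the one a program can test. Nonnegativity makes the absolute value
-- in the encoding of a ratio its actual numerator.
≤[]⇒cross : ∀ r → NonNegative r → ∀ k m → k ≤[ r ] m → k * ℚ.↧ₙ r ≤ ℤ.∣ ℚ.↥ r ∣ * m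
≤[]⇒cross r@(mkℚ (ℤ.+ n) e _) _ k m k≤
  with ℚᵘ.≤-respˡ-≃ (fraction k) (ℚᵘ.≤-respʳ-≃ (scaled-fraction r m) (ℚ.toℚᵘ-mono-≤ k≤))
... | *≤* cross = subst₂ _≤_ (cong (k *_) (*-identityʳ (suc e))) (*-identityʳ (n * m))
  (ℤ.drop‿+≤+ (subst₂ ℤ._≤_ (sym (ℤ.pos-* k (suc e * 1)))
    (trans (cong (ℤ._* ℤ.+ 1) (sym (ℤ.pos-* n m))) (sym (ℤ.pos-* (n * m) 1))) cross))

cross⇒≤[] : ∀ r → NonNegative r → ∀ k m → k * ℚ.↧ₙ r ≤ ℤ.∣ ℚ.↥ r ∣ * m → k ≤[ r ] m
cross⇒≤[] r@(mkℚ (ℤ.+ n) e _) _ k m cross = ℚ.toℚᵘ-cancel-≤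
  (ℚᵘ.≤-respˡ-≃ (ℚᵘ.≃-sym (fraction k)) (ℚᵘ.≤-respʳ-≃ (ℚᵘ.≃-sym (scaled-fraction r m))
    (*≤* (subst₂ ℤ._≤_ (ℤ.pos-* k (suc e * 1))
      (trans (ℤ.pos-* (n * m) 1) (cong (ℤ._* ℤ.+ 1) (ℤ.pos-* n m)))
      (ℤ.+≤+ (subst₂ _≤_ (cong (k *_) (sym (*-identityʳ (suc e)))) (sym (*-identityʳ (n * m))) cross))))))

≤[]-mono : ∀ r → NonNegative r → ∀ k {m m′} → m ≤ m′ → k ≤[ r ] m → k ≤[ r ] m′
≤[]-mono r r≥0 k {m} {m′} m≤m′ k≤ =
  cross⇒≤[] r r≥0 k m′ (≤-trans (≤[]⇒cross r r≥0 k m k≤) (*-monoʳ-≤ ℤ.∣ ℚ.↥ r ∣ m≤m′))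

-- Feasibility is undecidable in general, so the minimum exists only up to
-- double negation.
no-minimum⇒infeasible : ∀ Π N b → (∀ m → ¬ IsMinimum Π N b m) → ∀ H → ¬ Feasible Π N b H
no-minimum⇒infeasible Π N b ¬min H feasible = go (suc (second Π N H)) H feasible ≤-refl
  where
  go : ∀ n H → Feasible Π N b H → ¬ (second Π N H < n)
  go (suc n) H feasible H<n = ¬min (second Π N H)
    ((H , feasible , refl) , λ H′ feasible′ → ≮⇒≥ λ H′<H → go n H′ feasible′ (<-≤-trans H′<H (s≤s⁻¹ H<n)))

-- Rejection discards the middle candidate as well, so one halving bound serves both outcomes.
n∸[1+⌊n/2⌋]≤⌊n/2⌋ : ∀ n → n ∸ suc ⌊ n /2⌋ ≤ ⌊ n /2⌋
n∸[1+⌊n/2⌋]≤⌊n/2⌋ n = m≤n+o⇒m∸n≤o n (suc ⌊ n /2⌋) (begin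
  n                       ≡⟨ ⌊n/2⌋+⌈n/2⌉≡n n ⟨
  ⌊ n /2⌋ + ⌈ n /2⌉       ≤⟨ +-monoʳ-≤ ⌊ n /2⌋ (⌊n/2⌋-mono (n≤1+n (suc n))) ⟩
  ⌊ n /2⌋ + suc ⌊ n /2⌋   ≡⟨ +-suc ⌊ n /2⌋ ⌊ n /2⌋ ⟩
  suc ⌊ n /2⌋ + ⌊ n /2⌋   ∎)
  where open ≤-Reasoning

-- States and steps of the binary search

stateTy : Ty
stateTy = (nat ⊗ nat) ⊗ (solutionTy ⊗ (networkTy ⊗ nat))

-- The candidate budgets on the first objective are lo, …, lo + width; best is
-- the answer accepted at lo + width, or nothing as long as no budget has been accepted.
record Window (G : Graph) : Set where
  constructor window
  field
    lo width : ℕ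
    best     : Maybe (Subgraph G)

open Window

State : Set
State = Σ[ N ∈ Network ] ℕ × Window (graph N)

encState : State → ⟦ stateTy ⟧
encState (N , D , win) = (lo win , width win) , (encSolution (best win) , (encNetwork N , D))

middle : ∀ {G} → Window G → ℕ
middle win = lo win + ⌊ width win /2⌋

accept reject : ∀ {G} → Window G → Maybe (Subgraph G) → Window G
accept win s = window (lo win) ⌊ width win /2⌋ s
reject win s = window (suc (middle win)) (width win ∸ suc ⌊ width win /2⌋) (best win)

module _ {X : Set} where

  if-then-else : ∀ {inp : X → ⟦ σ ⟧} {b : X → Bool} {f g : X → ⟦ τ ⟧} →
                 PolyTime {X} {σ} {bool} inp b → PolyTime {X} {σ} {τ} inp f → PolyTime {X} {σ} {τ} inp g →
                 PolyTime {X} {σ} {τ} inp (λ x → if b x then f x else g x)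
  if-then-else {b = b} P Q R = (P ▵ apply id) ▸ branch b Q R

  respects : ∀ {inp : X → ⟦ σ ⟧} {f g : X → ⟦ τ ⟧} → (∀ x → f x ≡ g x) →
             PolyTime {X} {σ} {τ} inp f → PolyTime {X} {σ} {τ} inp g
  respects {inp = inp} f≗g P = polyTime (code P) (bound P) λ x →
    let (t , r , t≤) = runs P x in t , subst (λ y → code P ∙ inp x ⇓ y [ t ]) (f≗g x) r , t≤

module Search (A B : Objective) (S : SubgraphClass) (α β : Ratio)
              (α≥0 : ∀ N → NonNegative (α N)) (β≥0 : ∀ N → NonNegative (β N))
              (value : PolyTimeValue (under-d B)) (ratio : PolyTimeRatio β)
              (budget-bound : BoundedBudget A B S) where

  Π Π′ : Problem
  Π  = ⟨ under-c A , under-d B , S ⟩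
  Π′ = ⟨ under-d B , under-c A , S ⟩

  within-budget : ∀ N → ℕ → Subgraph (graph N) → Bool
  within-budget N D H = (under-d B N H * ℚ.↧ₙ (β N)) ≤ᵇ (ℤ.∣ ℚ.↥ (β N) ∣ * D)

  accepts : ∀ N → ℕ → Maybe (Subgraph (graph N)) → Bool
  accepts N D = maybe′ (within-budget N D) false

  next : ∀ N → ℕ → Window (graph N) → Maybe (Subgraph (graph N)) → Window (graph N)
  next N D win s = if accepts N D s then accept win s else reject win s

  -- The width is tested only after the subroutine has answered, which keeps the loop body free of
  -- branching around the call. The answer in the exit iteration is discarded.
  outcome : ∀ N → ℕ → Window (graph N) → Maybe (Subgraph (graph N)) → ⟦ stateTy ⊕ solutionTy ⟧
  outcome N D win s = if width win ≤ᵇ 0 then inj₂ (encSolution (best win)) else inj₁ (encState (N , D , next N D win s))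

  -- The 1 puts the top of the window strictly above the A-value of every solution within budget D,
  -- so that `nothing` is a truthful entry for it.
  initial : ∀ N → ℕ → Window (graph N)
  initial N D = window 0 (1 + cost-bound (proj₁ (proj₂ budget-bound)) (encNetwork N)) nothing

  Answered : Set
  Answered = Σ[ (N , _) ∈ State ] Maybe (Subgraph (graph N))

  encAnswered : Answered → ⟦ stateTy ⊗ solutionTy ⟧
  encAnswered (st , s) = encState st , encSolution s

  abstract

    value-polyTime : PolyTime {Σ[ N ∈ Network ] Subgraph (graph N)} {networkTy ⊗ subgraphTy} {nat}
                     (λ (N , H) → encNetwork N , encSubgraph H) (λ (N , H) → under-d B N H)
    value-polyTime = polyTime (proj₁ value) (proj₁ (proj₂ value)) (proj₂ (proj₂ value))

    ratio-polyTime : PolyTime {Network} {networkTy} {nat ⊗ nat} encNetwork (λ N → ℤ.∣ ℚ.↥ (β N) ∣ , ℚ.↧ₙ (β N))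
    ratio-polyTime = polyTime (proj₁ ratio) (proj₁ (proj₂ ratio)) (proj₂ (proj₂ ratio))

    initial-polyTime : PolyTime {Network × ℕ} {networkTy ⊗ nat} {stateTy}
                       (λ (N , D) → encNetwork N , D) (λ (N , D) → encState (N , D , initial N D))
    initial-polyTime =
      (apply (lit 0) ▵ (apply (lit 1) ▵ apply fst ▸ along (cost-bound-polyTime (proj₁ (proj₂ budget-bound)))) ▸ apply add)
      ▵ ((apply ! ▸ apply inl) ▵ apply id)

    query-polyTime : PolyTime {State} {stateTy} {networkTy ⊗ nat}
                     encState (λ (N , D , win) → encNetwork N , middle win)
    query-polyTime = (apply snd ▸ apply snd ▸ apply fst) ▵
      (apply fst ▸ apply fst ▵ apply fst ▸ apply snd ▸ apply half) ▸ apply add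

    within-budget-polyTime : PolyTime {Σ[ (N , _) ∈ State ] Subgraph (graph N)} {subgraphTy ⊗ stateTy} {bool}
                             (λ (st , H) → encSubgraph H , encState st) (λ ((N , D , _) , H) → within-budget N D H)
    within-budget-polyTime =
      (((network ▵ apply fst) ▸ along value-polyTime ▵ network ▸ along ratio-polyTime ▸ apply snd) ▸ apply mul ▵
       (network ▸ along ratio-polyTime ▸ apply fst ▵ apply snd ▸ apply snd ▸ apply snd ▸ apply snd) ▸ apply mul)
      ▸ apply leq
      where
      network : PolyTime {Σ[ (N , _) ∈ State ] Subgraph (graph N)} {subgraphTy ⊗ stateTy} {networkTy}
                (λ (st , H) → encSubgraph H , encState st) (λ ((N , D , _) , H) → encNetwork N)
      network = apply snd ▸ apply snd ▸ apply snd ▸ apply fst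

    accepts-polyTime : PolyTime {Answered} {stateTy ⊗ solutionTy} {bool}
                       encAnswered (λ ((N , D , _) , s) → accepts N D s)
    accepts-polyTime = (apply snd ▵ apply fst) ▸ branch-⊎ none within-budget-polyTime
      λ { (st , nothing) → inj₁ (st , refl , refl)
        ; (st , just H)  → inj₂ ((st , H) , refl , refl) }
      where
      none : PolyTime {State} {unit ⊗ stateTy} {bool} (λ st → tt , encState st) (λ _ → false)
      none = apply (bit false)

    outcome-polyTime : PolyTime {Answered} {stateTy ⊗ solutionTy} {stateTy ⊕ solutionTy}
                       encAnswered (λ ((N , D , win) , s) → outcome N D win s)
    outcome-polyTime = if-then-else ((width-polyTime ▵ apply (lit 0)) ▸ apply leq)
      (apply fst ▸ apply snd ▸ apply fst ▸ apply inr)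
      -- The program chooses between two encoded states, so `encState` has to be moved inside the
      -- conditional.
      (respects (λ ((N , D , win) , s) → sym (if-float (λ w → encState (N , D , w)) (accepts N D s)))
        (if-then-else accepts-polyTime accepted rejected) ▸ apply inl)
      where
      width-polyTime : PolyTime {Answered} {stateTy ⊗ solutionTy} {nat} encAnswered (λ ((_ , _ , win) , _) → width win)
      width-polyTime = apply fst ▸ apply fst ▸ apply snd

      accepted : PolyTime {Answered} {stateTy ⊗ solutionTy} {stateTy}
                 encAnswered (λ ((N , D , win) , s) → encState (N , D , accept win s))
      accepted = (apply fst ▸ apply fst ▸ apply fst ▵ width-polyTime ▸ apply half) ▵
                 (apply snd ▵ apply fst ▸ apply snd ▸ apply snd)

      suc-half : PolyTime {Answered} {stateTy ⊗ solutionTy} {nat}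
                 encAnswered (λ ((_ , _ , win) , _) → suc ⌊ width win /2⌋)
      suc-half = (apply (lit 1) ▵ width-polyTime ▸ apply half) ▸ apply add

      rejected : PolyTime {Answered} {stateTy ⊗ solutionTy} {stateTy}
                 encAnswered (λ ((N , D , win) , s) → encState (N , D , reject win s))
      rejected = ((apply (lit 1) ▵ (apply fst ▸ apply fst ▸ apply fst ▵ width-polyTime ▸ apply half) ▸ apply add) ▸ apply add ▵
                  (width-polyTime ▵ suc-half) ▸ apply monus) ▵
                 apply fst ▸ apply snd

  -- Correctness of the search

  Good : ∀ N → ℕ → ℕ → Maybe (Subgraph (graph N)) → Set
  Good N D hi nothing  = ∀ H → Feasible Π′ N D H → under-c A N H < hi
  Good N D hi (just H) = S (graph N) H × under-c A N H ≤[ α N ] hi × under-d B N H ≤[ β N ] D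

  record Invariant N D (win : Window (graph N)) : Set where
    field
      lower : ∀ H → Feasible Π′ N D H → lo win ≤ under-c A N H
      upper : Good N D (lo win + width win) (best win)

  open Invariant

  initial-invariant : ∀ N D → Invariant N D (initial N D)
  initial-invariant N D = record
    { lower = λ _ _ → z≤n
    ; upper = λ H (H∈S , B≤D) → let (C-hi , p , bounds , C-hi≤) = budget-bound in
        s≤s (≤-trans (bounds N D H H∈S B≤D) (≤-trans (C-hi≤ N D) (cost-bound-≥ p N))) }

  accepts-sound : ∀ N D H → within-budget N D H ≡ true → under-d B N H ≤[ β N ] D
  accepts-sound N D H eq = cross⇒≤[] (β N) (β≥0 N) (under-d B N H) D (≤ᵇ⇒≤ _ _ (subst T (sym eq) tt))

  accepts-complete : ∀ N D H → within-budget N D H ≡ false → ¬ (under-d B N H ≤[ β N ] D)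
  accepts-complete N D H eq B≤ = subst T eq (≤⇒≤ᵇ (≤[]⇒cross (β N) (β≥0 N) (under-d B N H) D B≤))

  rejected⇒infeasible : ∀ N D C s → Guarantee (α N) (β N) Π N C s → accepts N D s ≡ false →
                        ∀ H → Feasible Π′ N D H → C < under-c A N H
  rejected⇒infeasible N D C nothing none _ H (H∈S , _) = ≰⇒> λ A≤C → none (H , H∈S , A≤C)
  rejected⇒infeasible N D C (just H′) (_ , _ , near) eq H (H∈S , B≤D) = ≰⇒> λ A≤C →
    -- The goal is absurd, so it suffices to refute every minimum m: as m ≤ B(H) ≤ D, `near` would
    -- give the inequality that the test refused.
    no-minimum⇒infeasible Π N C
      (λ m min → accepts-complete N D H′ eq
        (≤[]-mono (β N) (β≥0 N) (under-d B N H′) (≤-trans (proj₂ min H (H∈S , A≤C)) B≤D) (near m min)))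
      H (H∈S , A≤C)

  accept-invariant : ∀ N D win s → Invariant N D win → Guarantee (α N) (β N) Π N (middle win) s →
                     accepts N D s ≡ true → Invariant N D (accept win s)
  accept-invariant N D win (just H) inv (H∈S , A≤ , _) eq = record
    { lower = lower inv ; upper = H∈S , A≤ , accepts-sound N D H eq }

  -- Rejection keeps the top end, to which `best` belongs. At w = 0 truncated subtraction would
  -- shift the top to l + 1.
  reject-upper : ∀ l w → 0 < w → suc (l + ⌊ w /2⌋) + (w ∸ suc ⌊ w /2⌋) ≡ l + w
  reject-upper l (suc w) _ = begin
    suc (l + h) + (suc w ∸ suc h)   ≡⟨ cong (_+ (suc w ∸ suc h)) (+-suc l h) ⟨
    l + suc h + (suc w ∸ suc h)     ≡⟨ +-assoc l (suc h) (suc w ∸ suc h) ⟩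
    l + (suc h + (suc w ∸ suc h))   ≡⟨ cong (l +_) (m+[n∸m]≡n (⌊n/2⌋<n w)) ⟩
    l + suc w                       ∎
    where
    open ≡-Reasoning
    h = ⌊ suc w /2⌋

  reject-invariant : ∀ N D win s → Invariant N D win → Guarantee (α N) (β N) Π N (middle win) s →
                     0 < width win → accepts N D s ≡ false → Invariant N D (reject win s)
  reject-invariant N D win s inv guarantee 0<w eq = record
    { lower = rejected⇒infeasible N D (middle win) s guarantee eq
    ; upper = subst (λ hi → Good N D hi (best win)) (sym (reject-upper (lo win) (width win) 0<w)) (upper inv) }

  -- `upper-≤` controls the digits of all numbers in the state, and `width-<` makes k the fuel of
  -- the search.
  record Progress N D (W k : ℕ) (win : Window (graph N)) : Set where
    field
      invariant : Invariant N D win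
      upper-≤   : lo win + width win ≤ W
      width-<   : width win < 2 ^ k

  open Progress

  next-progress : ∀ N D W k win s → Progress N D W (suc k) win → 0 < width win →
                  Guarantee (α N) (β N) Π N (middle win) s → Progress N D W k (next N D win s)
  next-progress N D W k win s prog 0<w guarantee = go (accepts N D s) refl
    where
    half-<2^ : ⌊ width win /2⌋ < 2 ^ k
    half-<2^ = half-< (subst (width win <_) (2^-double k) (width-< prog))

    go : ∀ b → accepts N D s ≡ b → Progress N D W k (if b then accept win s else reject win s)
    go true  eq = record
      { invariant = accept-invariant N D win s (invariant prog) guarantee eq
      ; upper-≤   = ≤-trans (+-monoʳ-≤ (lo win) (⌊n/2⌋≤n (width win))) (upper-≤ prog)
      ; width-<   = half-<2^ }
    go false eq = record
      { invariant = reject-invariant N D win s (invariant prog) guarantee 0<w eq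
      ; upper-≤   = ≤-trans (≤-reflexive (reject-upper (lo win) (width win) 0<w)) (upper-≤ prog)
      ; width-<   = ≤-<-trans (n∸[1+⌊n/2⌋]≤⌊n/2⌋ (width win)) half-<2^ }

  -- At width 0 the two ends meet. With `nothing`, a solution within D would lie both strictly below
  -- the common end and not below it. With `just H`, every such solution has A-value at least that
  -- end, which `upper` compares with H.
  stop-guarantee : ∀ N D win → Invariant N D win → width win ≡ 0 → Guarantee (β N) (α N) Π′ N D (best win)
  stop-guarantee N D (window l .0 nothing) inv refl (H , feasible) =
    <⇒≱ (upper inv H feasible) (≤-trans (≤-reflexive (+-identityʳ l)) (lower inv H feasible))
  stop-guarantee N D (window l .0 (just H)) inv refl =
    let (H∈S , A≤ , B≤) = upper inv in
    H∈S , B≤ , λ { m ((H′ , feasible , refl) , _) →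
      ≤[]-mono (α N) (α≥0 N) (under-c A N H) (≤-trans (≤-reflexive (+-identityʳ l)) (lower inv H′ feasible)) A≤ }

  -- The transformed program and its running time

  instanceTy : Ty
  instanceTy = networkTy ⊗ nat

  transformer : Prog (Hole instanceTy solutionTy) instanceTy solutionTy
  transformer = lift (code initial-polyTime) ⨾
    loop (pair (prim id) (lift (code query-polyTime) ⨾ call hole) ⨾ lift (code outcome-polyTime))

  iteration : Closed instanceTy solutionTy → Closed stateTy (stateTy ⊕ solutionTy)
  iteration P = pair (prim id) (code query-polyTime ⨾ P) ⨾ code outcome-polyTime

  plug-transformer : ∀ P → plug transformer P ≡ code initial-polyTime ⨾ loop (iteration P)
  plug-transformer P = cong₂ (λ p q → p ⨾ loop q) (plug-lift (code initial-polyTime) P)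
    (cong₂ (λ p q → pair (prim id) (p ⨾ P) ⨾ q) (plug-lift (code query-polyTime) P) (plug-lift (code outcome-polyTime) P))

  initial-width : Network → ℕ → ℕ
  initial-width N D = width (initial N D)

  initial-size : Network → ℕ → ℕ
  initial-size N D = size stateTy (encState (N , D , initial N D))

  -- The initial state already contains the network and the largest candidate budget, hence can
  -- serve as the unit for all later sizes.
  size-query : ∀ N D C → C ≤ initial-width N D → size instanceTy (encNetwork N , C) ≤ initial-size N D
  size-query N D C C≤W = begin
    suc (n + size nat C)                                     ≤⟨ s≤s (+-monoʳ-≤ n (size-nat-mono C≤W)) ⟩
    suc (n + w)                                              ≤⟨ m≤m+n (suc (n + w)) (6 + δ) ⟩
    suc (n + w) + (6 + δ)                                    ≡⟨ collect n w δ ⟩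
    initial-size N D                                         ∎
    where
    open ≤-Reasoning
    n = size networkTy (encNetwork N)
    w = size nat (initial-width N D)
    δ = size nat D
    collect : ∀ n w δ → 1 + (n + w) + (6 + δ) ≡ 1 + ((1 + (1 + w)) + (1 + (2 + (1 + (n + δ)))))
    collect = solve-∀

  -- Only `lo` and `best` can outgrow their initial values, the first up to the digits of the
  -- initial width, the second up to the size of the network; doubling covers both.
  size-state : ∀ N D win → lo win + width win ≤ initial-width N D →
               size stateTy (encState (N , D , win)) ≤ 2 * initial-size N D
  size-state N D win hi≤W = begin
    suc (suc (size nat (lo win) + size nat (width win)) + suc (size solutionTy (encSolution (best win)) + suc (n + δ)))
      ≤⟨ s≤s (+-mono-≤
           (s≤s (+-mono-≤ (size-nat-mono (≤-trans (m≤m+n (lo win) (width win)) hi≤W))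
                          (size-nat-mono (≤-trans (m≤n+m (width win) (lo win)) hi≤W))))
           (s≤s (+-monoˡ-≤ (suc (n + δ)) (size-encSolution N (best win))))) ⟩
    suc (suc (w + w) + suc (suc n + suc (n + δ)))                    ≤⟨ m≤m+n _ (9 + δ) ⟩
    suc (suc (w + w) + suc (suc n + suc (n + δ))) + (9 + δ)          ≡⟨ collect n w δ ⟩
    2 * initial-size N D                                             ∎
    where
    open ≤-Reasoning
    n = size networkTy (encNetwork N)
    w = size nat (initial-width N D)
    δ = size nat D
    collect : ∀ n w δ → 1 + (1 + (w + w) + (1 + (1 + n + (1 + (n + δ))))) + (9 + δ) ≡
                        2 * (1 + ((1 + (1 + w)) + (1 + (2 + (1 + (n + δ))))))
    collect = solve-∀

  size-answered : ∀ N D win s → lo win + width win ≤ initial-width N D →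
                  size (stateTy ⊗ solutionTy) (encState (N , D , win) , encSolution s) ≤ 3 * initial-size N D
  size-answered N D win s hi≤W = begin
    suc (size stateTy (encState (N , D , win)) + size solutionTy (encSolution s))
      ≤⟨ s≤s (+-mono-≤ (size-state N D win hi≤W) (size-encSolution N s)) ⟩
    suc (2 * z + suc n)                   ≡⟨ shift z n ⟩
    2 + n + 2 * z                         ≤⟨ +-monoˡ-≤ (2 * z) (≤-trans (m≤m+n (2 + n) (5 + w + δ)) (≤-reflexive (collect n w δ))) ⟩
    3 * z                                 ∎
    where
    open ≤-Reasoning
    z = initial-size N D
    n = size networkTy (encNetwork N)
    w = size nat (initial-width N D)
    δ = size nat D
    shift : ∀ z n → 1 + (2 * z + (1 + n)) ≡ 2 + n + 2 * z
    shift = solve-∀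
    collect : ∀ n w δ → 2 + n + (5 + w + δ) ≡ 1 + ((1 + (1 + w)) + (1 + (2 + (1 + (n + δ)))))
    collect = solve-∀

  -- `identity` pays for the `prim id` that keeps the state beside the answer.
  overhead : Poly
  overhead = identity ⊞ bound query-polyTime ⊞ bound outcome-polyTime

  eval-overhead : ∀ n → eval overhead n ≡ n + eval (bound query-polyTime) n + eval (bound outcome-polyTime) n
  eval-overhead n = trans (eval-⊞ _ (bound outcome-polyTime) n)
    (cong (_+ eval (bound outcome-polyTime) n) (trans (eval-⊞ identity (bound query-polyTime) n)
      (cong (_+ eval (bound query-polyTime) n) (eval-identity n))))

  module _ (P : ApproximationAlgorithm α β Π) where

    iteration-bound : ℕ → ℕ
    iteration-bound M = eval overhead M + eval (time P) M

    iteration-runs : ∀ N D win → lo win + width win ≤ initial-width N D →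
      ∃[ s ] ∃[ t ] ( iteration (program P) ∙ encState (N , D , win) ⇓ outcome N D win s [ t ]
                    × t ≤ iteration-bound (3 * initial-size N D)
                    × Guarantee (α N) (β N) Π N (middle win) s )
    iteration-runs N D win hi≤W =
      let (s , t₂ , r₂ , t₂≤ , guarantee) = correct P N (middle win)
          (t₁ , r₁ , t₁≤) = runs query-polyTime (N , D , win)
          (t₃ , r₃ , t₃≤) = runs outcome-polyTime ((N , D , win) , s)
      in s , _ , ⇓⨾ (⇓pair ⇓prim (⇓⨾ r₁ r₂)) r₃ ,
         total t₁ t₂ t₃
           (≤-trans t₁≤ (eval-mono (bound query-polyTime) size≤M))
           (≤-trans t₂≤ (eval-mono (time P) (≤-trans (size-query N D (middle win)
             (≤-trans (+-monoʳ-≤ (lo win) (⌊n/2⌋≤n (width win))) hi≤W)) (m≤n*m _ 3))))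
           (≤-trans t₃≤ (eval-mono (bound outcome-polyTime) (size-answered N D win s hi≤W))) ,
         guarantee
      where
      M = 3 * initial-size N D
      size≤M : size stateTy (encState (N , D , win)) ≤ M
      size≤M = ≤-trans (size-state N D win hi≤W) (*-monoˡ-≤ (initial-size N D) {2} {3} (s≤s (s≤s z≤n)))

      rearrange : ∀ m a b c → m + (a + b) + c ≡ m + a + c + b
      rearrange = solve-∀

      total : ∀ t₁ t₂ t₃ → t₁ ≤ eval (bound query-polyTime) M → t₂ ≤ eval (time P) M →
              t₃ ≤ eval (bound outcome-polyTime) M →
              size stateTy (encState (N , D , win)) + (t₁ + t₂) + t₃ ≤ iteration-bound M
      total t₁ t₂ t₃ t₁≤ t₂≤ t₃≤ = ≤-trans
        (+-mono-≤ (+-mono-≤ size≤M (+-mono-≤ t₁≤ t₂≤)) t₃≤)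
        (≤-reflexive (trans (rearrange M _ _ _) (cong (_+ eval (time P) M) (sym (eval-overhead M)))))

    -- At most k halvings bring a width below 2 ^ k to 0; the `suc` accounts for the exit iteration.
    search : ∀ N D k win → Progress N D (initial-width N D) k win →
      ∃[ s ] ∃[ t ] ( loop (iteration (program P)) ∙ encState (N , D , win) ⇓ encSolution s [ t ]
                    × t ≤ suc k * iteration-bound (3 * initial-size N D)
                    × Guarantee (β N) (α N) Π′ N D s )
    search N D k win@(window l zero b) prog =
      let (s , t , r , t≤ , _) = iteration-runs N D win (upper-≤ prog)
      in b , t , ⇓stop r , ≤-trans t≤ (m≤m+n _ _) , stop-guarantee N D win (invariant prog) refl
    search N D zero (window l (suc w) b) prog = ⊥-elim (<⇒≱ (width-< prog) (s≤s z≤n))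
    search N D (suc k) win@(window l (suc w) b) prog =
      let (s , t , r , t≤ , guarantee) = iteration-runs N D win (upper-≤ prog)
          (s′ , t′ , r′ , t′≤ , guarantee′) = search N D k (next N D win s)
            (next-progress N D (initial-width N D) k win s prog (s≤s z≤n) guarantee)
      in s′ , t + t′ , ⇓next r r′ , +-mono-≤ t≤ t′≤ , guarantee′

  -- The initial state is an output, so its size is at most `growth` times the time spent on it; the
  -- 3 covers a state (2) together with an answer (1).
  size-bound : Poly
  size-bound = constant (3 * growth (code initial-polyTime)) ⊠ bound initial-polyTime

  -- A single polynomial must bound the extra work, the number of calls and the size of the calls.
  -- The added ones make it dominate `size-bound` and allow the total to be completed to a product.
  transformation-bound : Poly
  transformation-bound = bound initial-polyTime ⊞ (constant 1 ⊞ size-bound) ⊠ (constant 1 ⊞ overhead ⊚ size-bound)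

  eval-transformation-bound : ∀ n → eval transformation-bound n ≡
    eval (bound initial-polyTime) n + suc (eval size-bound n) * suc (eval overhead (eval size-bound n))
  eval-transformation-bound n = trans (eval-⊞ (bound initial-polyTime) _ n)
    (cong (eval (bound initial-polyTime) n +_) (trans (eval-⊠ (constant 1 ⊞ size-bound) _ n)
      (cong₂ _*_ (eval-suc size-bound) (trans (eval-suc (overhead ⊚ size-bound)) (cong suc (eval-⊚ overhead size-bound n))))))
    where
    eval-suc : ∀ p → eval (constant 1 ⊞ p) n ≡ suc (eval p n)
    eval-suc p = trans (eval-⊞ (constant 1) p n) (cong (_+ eval p n) (eval-constant 1 n))

  size-bound-≤ : ∀ n → eval size-bound n ≤ eval transformation-bound n
  size-bound-≤ n = subst (m ≤_) (sym (eval-transformation-bound n))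
    (≤-trans (n≤1+n m) (≤-trans (m≤m*n (suc m) (suc (eval overhead m))) (m≤n+m _ (eval (bound initial-polyTime) n))))
    where m = eval size-bound n

  time-bound : Poly → Poly
  time-bound p = transformation-bound ⊠ (constant 1 ⊞ p ⊚ transformation-bound)

  eval-time-bound : ∀ p n → eval (time-bound p) n ≡
    eval transformation-bound n * suc (eval p (eval transformation-bound n))
  eval-time-bound p n = trans (eval-⊠ transformation-bound _ n) (cong (eval transformation-bound n *_)
    (trans (eval-⊞ (constant 1) _ n) (cong₂ _+_ (eval-constant 1 n) (eval-⊚ p transformation-bound n))))

  total-time : ∀ p n t t′ k M → t ≤ eval (bound initial-polyTime) n → k ≤ M → M ≤ eval size-bound n →
               t′ ≤ suc k * (eval overhead M + eval p M) → t + t′ ≤ eval (time-bound p) n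
  total-time p n t t′ k M t≤ k≤M M≤m t′≤ = begin
    t + t′                                                ≤⟨ +-mono-≤ t≤ t′≤ ⟩
    i + suc k * (eval overhead M + eval p M)              ≤⟨ +-monoʳ-≤ i (*-mono-≤ (s≤s (≤-trans k≤M M≤m))
                                                               (+-mono-≤ (eval-mono overhead M≤m)
                                                                 (eval-mono p (≤-trans M≤m (size-bound-≤ n))))) ⟩
    -- The slack consists of exactly the missing terms of the product (i + (1 + m)(1 + o))(1 + e).
    i + suc m * (o + e)                                   ≤⟨ m≤m+n _ (i * e + suc m * (1 + o * e)) ⟩
    i + suc m * (o + e) + (i * e + suc m * (1 + o * e))   ≡⟨ expand i m o e ⟩
    (i + suc m * suc o) * suc e                           ≡⟨ cong (_* suc e) (eval-transformation-bound n) ⟨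
    eval transformation-bound n * suc e                   ≡⟨ eval-time-bound p n ⟨
    eval (time-bound p) n                                 ∎
    where
    open ≤-Reasoning
    i = eval (bound initial-polyTime) n
    m = eval size-bound n
    o = eval overhead m
    e = eval p (eval transformation-bound n)
    expand : ∀ i m o e → i + (1 + m) * (o + e) + (i * e + (1 + m) * (1 + o * e)) ≡ (i + (1 + m) * (1 + o)) * (1 + e)
    expand = solve-∀

  initial-progress : ∀ N D → Progress N D (initial-width N D) (size nat (initial-width N D)) (initial N D)
  initial-progress N D = record
    { invariant = initial-invariant N D ; upper-≤ = ≤-refl ; width-< = n<2^size (initial-width N D) }

  initial-size-≤ : ∀ N D {t} → code initial-polyTime ∙ (encNetwork N , D) ⇓ encState (N , D , initial N D) [ t ] →
                   t ≤ eval (bound initial-polyTime) (size instanceTy (encNetwork N , D)) →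
                   3 * initial-size N D ≤ eval size-bound (size instanceTy (encNetwork N , D))
  initial-size-≤ N D {t} r t≤ = begin
    3 * initial-size N D                            ≤⟨ *-monoʳ-≤ 3 (≤-trans (size-output r) (*-monoʳ-≤ g t≤)) ⟩
    3 * (g * eval (bound initial-polyTime) n)       ≡⟨ *-assoc 3 g _ ⟨
    3 * g * eval (bound initial-polyTime) n         ≡⟨ cong (_* eval (bound initial-polyTime) n) (eval-constant (3 * g) n) ⟨
    eval (constant (3 * g)) n * eval (bound initial-polyTime) n  ≡⟨ eval-⊠ (constant (3 * g)) _ n ⟨
    eval size-bound n                               ∎
    where
    open ≤-Reasoning
    n = size instanceTy (encNetwork N , D)
    g = growth (code initial-polyTime)

  -- The fuel is the digit count of the initial width, and those digits are stored in the initial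
  -- state. So the number of iterations is polynomial although the width may be exponential.
  width-size-≤ : ∀ N D → size nat (initial-width N D) ≤ 3 * initial-size N D
  width-size-≤ N D = ≤-trans (≤-trans (m≤n+m _ (suc (size networkTy (encNetwork N)))) (size-query N D _ ≤-refl))
    (m≤n*m (initial-size N D) 3)

  transformed : ApproximationAlgorithm α β Π → ApproximationAlgorithm β α Π′
  transformed P = record
    { program = plug transformer (program P)
    ; time    = time-bound (time P)
    ; correct = λ N D →
        let (t₀ , r₀ , t₀≤) = runs initial-polyTime (N , D)
            (s , t , r , t≤ , guarantee) = search P N D (size nat (initial-width N D)) (initial N D) (initial-progress N D)
        in s , t₀ + t ,
           subst (λ p → p ∙ (encNetwork N , D) ⇓ encSolution s [ t₀ + t ]) (sym (plug-transformer (program P))) (⇓⨾ r₀ r) ,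
           total-time (time P) _ t₀ t (size nat (initial-width N D)) (3 * initial-size N D) t₀≤
             (width-size-≤ N D) (initial-size-≤ N D r₀ t₀≤) t≤ ,
           guarantee }

theorem5p2 : (A B : Objective) (S : SubgraphClass) (α β : Ratio) →
    (∀ N → NonNegative (α N)) →
    (∀ N → NonNegative (β N)) →
    PolyTimeValue (under-d B) →
    PolyTimeRatio β →
    Monotone ⟨ under-c A , under-d B , S ⟩ →
    Monotone ⟨ under-d B , under-c A , S ⟩ →
    BoundedBudget A B S →
    PolyTimeTransformable
    α β ⟨ under-c A , under-d B , S ⟩
    β α ⟨ under-d B , under-c A , S ⟩
theorem5p2 A B S α β α≥0 β≥0 value ratio _ _ budget-bound =
  transformer , transformation-bound , λ P → transformed P , refl , λ s → ≤-reflexive (eval-time-bound (time P) s)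
  where open Search A B S α β α≥0 β≥0 value ratio budget-bound
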